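{- Let $U=U_1\times\cdots\times U_m$ be a Cartesian product of nonempty finite sets. Given a set $S\subseteq U$ (as a list of $m$-tuples), it can be decided in time polynomial in the size of the input, i.e. in $|S|$ and $m$, whether $S$ is ample.
   Context: A generalized partition of $U$ is a tuple $\Lambda=(\alpha_1,\dots,\alpha_m)$ with $\alpha_i$ a partition of $U_i$ into nonempty blocks; it defines a partition of $U$ into the boxes $P^1\times\cdots\times P^m$, $P^i\in\alpha_i$, and the minor-subproduct $M(\Lambda)=M_1\times\cdots\times M_m$, where $M_i$ is the set of blocks of $\alpha_i$. $M(\Lambda)$ is shattered by $S\subseteq U$ if $S$ meets every box of the box-partition. A copy of $M(\Lambda)$ is a set $W_1\times\cdots\times W_m$ where $W_i$ consists of exactly one element from each block of $\alpha_i$. $M(\Lambda)$ is strongly shattered by $S$ if $S$ contains a copy of it. $S$ is ample if every minor-subproduct of $U$ shattered by $S$ is strongly shattered by $S$. -}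

module Defs where

open import Data.Bool using (Bool; true; false; if_then_else_)
open import Data.Fin using (Fin; toℕ)
open import Data.Fin.Subset using (Subset; _∈_; Nonempty)
open import Data.List using (List; foldr; map; tabulate)
open import Data.List.Membership.Setoid using () renaming (_∈_ to Member)
open import Data.List.Relation.Unary.Unique.Setoid using () renaming (Unique to UniqueIn)
open import Data.Nat using (ℕ; suc; _+_; _≡ᵇ_)
open import Data.Product using (∃; ∃!; _×_)
open import Data.Vec using (Vec; []; _∷_; lookup)
open import Level using (0ℓ)
open import Relation.Binary.Bundles using (Setoid)
open import Relation.Binary.PropositionalEquality using (_≡_; refl; sym; trans)
open import Relation.Unary using (Pred; _⊆_; _≬_)

------------------------------------------------------------------------
-- Ample subsets of a Cartesian product U₁ × ⋯ × Uₘ, where Uᵢ = Fin (n i)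

Tuple : ∀ {m} → (Fin m → ℕ) → Set
Tuple n = ∀ i → Fin (n i)

-- Tuples are functions, so they are compared coordinatewise.
tupleSetoid : ∀ {m} → (Fin m → ℕ) → Setoid 0ℓ 0ℓ
tupleSetoid n = record
  { Carrier       = Tuple n
  ; _≈_           = λ s t → ∀ i → s i ≡ t i
  ; isEquivalence = record
    { refl  = λ i → refl
    ; sym   = λ p i → sym (p i)
    ; trans = λ p q i → trans (p i) (q i)
    }
  }

-- Blocks are numbered; `disjoint` says both that different blocks are
-- disjoint and, with `nonempty`, that no block is listed twice.
record Partition (n : ℕ) : Set where
  field
    size     : ℕ
    block    : Fin size → Subset n
    nonempty : ∀ b → Nonempty (block b)
    disjoint : ∀ {a b x} → x ∈ block a → x ∈ block b → a ≡ b
    covering : ∀ x → ∃ λ b → x ∈ block b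

open Partition public

module _ {m} {n : Fin m → ℕ} where

  Product : (∀ i → Subset (n i)) → Pred (Tuple n) 0ℓ
  Product W u = ∀ i → u i ∈ W i

  GeneralizedPartition : Set
  GeneralizedPartition = ∀ i → Partition (n i)

  MinorSubproduct : GeneralizedPartition → Set
  MinorSubproduct Λ = ∀ i → Fin (size (Λ i))

  Box : (Λ : GeneralizedPartition) → MinorSubproduct Λ → Pred (Tuple n) 0ℓ
  Box Λ P = Product (λ i → block (Λ i) (P i))

  Shattered : GeneralizedPartition → Pred (Tuple n) 0ℓ → Set
  Shattered Λ S = ∀ P → S ≬ Box Λ P

  -- The product of the Wᵢ is a copy of M(Λ).
  IsCopy : GeneralizedPartition → (∀ i → Subset (n i)) → Set
  IsCopy Λ W = ∀ i b → ∃! _≡_ λ x → x ∈ W i × x ∈ block (Λ i) b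

  StronglyShattered : GeneralizedPartition → Pred (Tuple n) 0ℓ → Set
  StronglyShattered Λ S = ∃ λ W → IsCopy Λ W × Product W ⊆ S

  Ample : Pred (Tuple n) 0ℓ → Set
  Ample S = ∀ Λ → Shattered Λ S → StronglyShattered Λ S

  elements : List (Tuple n) → Pred (Tuple n) 0ℓ
  elements S u = Member (tupleSetoid n) u S

  Unique : List (Tuple n) → Set
  Unique = UniqueIn (tupleSetoid n)

------------------------------------------------------------------------
-- Computation: a first-order, call-by-value functional language on binary
-- trees with labelled leaves. Each evaluation rule is a bounded number of
-- pointer operations on a heap with sharing and at most one comparison of
-- two labels, so that evaluation cost agrees, up to a polynomial, with
-- Turing machine time. Labels can be copied and tested for equality, but
-- not computed with; in particular no number can be smuggled into a label.

data Value : Set where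
  nil  : Value
  atom : ℕ → Value
  cons : Value → Value → Value

-- Expressions with n free variables (de Bruijn indices) over k mutually
-- recursive functions of the given arities.
data Expr {k : ℕ} (arity : Fin k → ℕ) (n : ℕ) : Set where
  var     : Fin n → Expr arity n
  nil     : Expr arity n
  cons    : Expr arity n → Expr arity n → Expr arity n
  let-in  : Expr arity n → Expr arity (suc n) → Expr arity n
  -- The third argument binds the head (variable 0) and the tail (variable 1).
  case    : Expr arity n → Expr arity n → Expr arity (suc (suc n)) → Expr arity n
  if-same : Expr arity n → Expr arity n → Expr arity n → Expr arity n → Expr arity n
  call    : (f : Fin k) → Vec (Expr arity n) (arity f) → Expr arity n

record Program : Set where
  field
    functions : ℕ
    arity     : Fin functions → ℕ
    body      : (f : Fin functions) → Expr arity (arity f)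
    main      : Expr arity 1

module Semantics (p : Program) where
  open Program p

  Env : ℕ → Set
  Env = Vec Value

  infix 4 _⊢_⇓_⟨_⟩ _⊢*_⇓_⟨_⟩

  -- ρ ⊢ e ⇓ v ⟨ t ⟩: in environment ρ, e evaluates to v in t steps. Taking
  -- the head or tail of an atom, or comparing anything but atoms, is stuck.
  mutual
    data _⊢_⇓_⟨_⟩ {n} (ρ : Env n) : Expr arity n → Value → ℕ → Set where
      ⇓var : ∀ {x} → ρ ⊢ var x ⇓ lookup ρ x ⟨ 1 ⟩
      ⇓nil : ρ ⊢ nil ⇓ nil ⟨ 1 ⟩
      ⇓cons : ∀ {e₁ e₂ v₁ v₂ t₁ t₂} →
        ρ ⊢ e₁ ⇓ v₁ ⟨ t₁ ⟩ → ρ ⊢ e₂ ⇓ v₂ ⟨ t₂ ⟩ →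
        ρ ⊢ cons e₁ e₂ ⇓ cons v₁ v₂ ⟨ suc (t₁ + t₂) ⟩
      ⇓let : ∀ {e₁ e₂ v₁ v₂ t₁ t₂} →
        ρ ⊢ e₁ ⇓ v₁ ⟨ t₁ ⟩ → v₁ ∷ ρ ⊢ e₂ ⇓ v₂ ⟨ t₂ ⟩ →
        ρ ⊢ let-in e₁ e₂ ⇓ v₂ ⟨ suc (t₁ + t₂) ⟩
      ⇓case-nil : ∀ {e e₁ e₂ v t t₁} →
        ρ ⊢ e ⇓ nil ⟨ t ⟩ → ρ ⊢ e₁ ⇓ v ⟨ t₁ ⟩ →
        ρ ⊢ case e e₁ e₂ ⇓ v ⟨ suc (t + t₁) ⟩
      ⇓case-cons : ∀ {e e₁ e₂ x y v t t₂} →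
        ρ ⊢ e ⇓ cons x y ⟨ t ⟩ → x ∷ y ∷ ρ ⊢ e₂ ⇓ v ⟨ t₂ ⟩ →
        ρ ⊢ case e e₁ e₂ ⇓ v ⟨ suc (t + t₂) ⟩
      ⇓if-same : ∀ {e₁ e₂ e₃ e₄ a b v t₁ t₂ t} →
        ρ ⊢ e₁ ⇓ atom a ⟨ t₁ ⟩ → ρ ⊢ e₂ ⇓ atom b ⟨ t₂ ⟩ →
        ρ ⊢ (if a ≡ᵇ b then e₃ else e₄) ⇓ v ⟨ t ⟩ →
        ρ ⊢ if-same e₁ e₂ e₃ e₄ ⇓ v ⟨ suc (t₁ + t₂ + t) ⟩
      ⇓call : ∀ {f es vs v t₁ t₂} →
        ρ ⊢* es ⇓ vs ⟨ t₁ ⟩ → vs ⊢ body f ⇓ v ⟨ t₂ ⟩ →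
        ρ ⊢ call f es ⇓ v ⟨ suc (t₁ + t₂) ⟩

    data _⊢*_⇓_⟨_⟩ {n} (ρ : Env n) : ∀ {j} → Vec (Expr arity n) j → Vec Value j → ℕ → Set where
      ⇓[] : ρ ⊢* [] ⇓ [] ⟨ 0 ⟩
      ⇓∷ : ∀ {j e v t₁ t₂} {es : Vec (Expr arity n) j} {vs : Vec Value j} →
        ρ ⊢ e ⇓ v ⟨ t₁ ⟩ → ρ ⊢* es ⇓ vs ⟨ t₂ ⟩ →
        ρ ⊢* e ∷ es ⇓ v ∷ vs ⟨ t₁ + t₂ ⟩

-- On input v, the program p halts with output w after t steps.
Run : Program → Value → Value → ℕ → Set
Run p v w t = v ∷ [] ⊢ Program.main p ⇓ w ⟨ t ⟩
  where open Semantics p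

encodeBool : Bool → Value
encodeBool false = nil
encodeBool true  = cons nil nil

encodeList : List Value → Value
encodeList = foldr cons nil

-- The elements of the factors enter the input only as labels, so the size
-- of an encoded list depends on its length and on m alone.
encodeTuple : ∀ {m} {n : Fin m → ℕ} → Tuple n → Value
encodeTuple s = encodeList (tabulate λ i → atom (toℕ (s i)))

encode : ∀ {m} {n : Fin m → ℕ} → List (Tuple n) → Value
encode S = encodeList (map encodeTuple S)

-- S is ample exactly if it has an exchange property for binary cubes: whenever
-- S contains two parallel cubes whose antipodes are p, q and p′, q′, and p and
-- p′ differ at i, then S contains a cube with the additional direction i that
-- lies between them. A cube is determined by a pair of antipodes, so this is a
-- first-order property of S and the set of coordinates, and evaluating a fixed
-- first-order formula takes polynomial time.
--
-- Ample sets have the exchange property because intersecting an ample set with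
-- a product of subsets A i keeps it ample. Conversely, replace partitions by
-- colourings and let S shatter a product A; shrink A as long as it remains
-- shattered. If two elements of A i of the same colour cannot be removed, there
-- are boxes that S meets only in points with these i-th coordinates. By
-- minimality the two boxes involve all colours of all coordinates, and comparing
-- three such boxes shows that every A i has at most two elements, unless S need
-- only meet A. In the remaining case of a binary cube, the exchange property
-- builds a copy one coordinate at a time.
module Submission where

open import Defs
open import Data.Bool using (Bool; true; false; if_then_else_; not; _∧_; _∨_)
open import Data.Bool.ListAction using (all)
open import Data.Empty using (⊥)
open import Data.Fin as Fin using (Fin; zero; suc; toℕ; fromℕ<; #_)
open import Data.Fin.Properties using (any?; all?; toℕ<n; toℕ-injective; toℕ-fromℕ<)
open import Data.Fin.Subset using (Subset; _∈_; _∉_; ⊤; ∣_∣) renaming (_⊆_ to _⊆ˢ_)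
open import Data.Fin.Subset.Properties using (_∈?_; ∈⊤; p⊆q⇒∣p∣≤∣q∣; p⊂q⇒∣p∣<∣q∣)
open import Data.List as List using (List; []; _∷_; length; deduplicate)
open import Data.List.Membership.Setoid using () renaming (_∈_ to Member)
open import Data.List.Membership.Propositional.Properties using (∈-tabulate⁺; ∈-tabulate⁻; ∈-deduplicate⁺; ∈-deduplicate⁻; ∈-lookup)
open import Data.List.Relation.Unary.All as All using ([]; _∷_)
open import Data.List.Relation.Unary.AllPairs using ([]; _∷_)
open import Data.List.Relation.Unary.Any as Any using (here; there; index)
open import Data.List.Relation.Unary.Any.Properties using (lookup-index)
open import Data.List.Relation.Unary.Unique.DecPropositional.Properties using (deduplicate-!)
open import Data.List.Relation.Unary.Unique.Propositional using () renaming (Unique to UniqueList)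
open import Data.Nat as ℕ using (ℕ; zero; suc; _+_; _*_; _^_; _≤_; _<_; z≤n; s≤s; s≤s⁻¹; NonZero)
open import Data.Nat.Induction using (<-wellFounded)
open import Data.Nat.Properties
open import Data.Nat.Tactic.RingSolver using (solve-∀)
open import Data.Product using (Σ-syntax; ∃; ∃₂; _×_; _,_; proj₁; proj₂; map₂)
open import Data.Product.Properties using (≡-dec)
open import Data.Sum as Sum using (_⊎_; inj₁; inj₂; [_,_]′)
open import Data.Vec as Vec using (Vec; []; _∷_; lookup)
open import Data.Vec.Properties using (lookup∘tabulate; lookup⇒[]=; []=⇒lookup)
open import Data.Vec.Functional using () renaming (_∷_ to _◂_)
open import Function using (_∘_; id)
open import Induction.WellFounded using (Acc; acc)
open import Level using (0ℓ)
open import Relation.Binary using (Rel; _Respects_)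
open import Relation.Binary.PropositionalEquality
open import Relation.Nullary using (¬_; Dec; yes; no; does; contradiction; toSum)
open import Relation.Nullary.Decidable using (map′; dec-true; dec-false; _×-dec_; _⊎-dec_; ¬?; decidable-stable)
open import Relation.Nullary.Reflects using (Reflects; ofʸ; ofⁿ; invert; fromEquivalence; _×-reflects_; _→-reflects_)
open import Relation.Unary using (Pred; Decidable)

-- Ample sets and colourings

infixr 5 _∷ᵗ_

_∷ᵗ_ : ∀ {m} {n : Fin (suc m) → ℕ} → Fin (n zero) → Tuple (n ∘ suc) → Tuple n
(x ∷ᵗ u) zero    = x
(x ∷ᵗ u) (suc i) = u i

_≐_ : ∀ {m} {n : Fin m → ℕ} → Rel (Tuple n) 0ℓ
u ≐ v = ∀ i → u i ≡ v i

-- A tuple rebuilt from its head and tail is only pointwise equal to the original, so `P` has to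
-- respect `_≐_`.
anyTuple? : ∀ {m} {n : Fin m → ℕ} {P : Pred (Tuple n) 0ℓ} →
  P Respects _≐_ → Decidable P → Dec (∃ P)
anyTuple? {zero}  resp P? = map′ (_ ,_) (λ (u , pu) → resp (λ ()) pu) (P? λ ())
anyTuple? {suc m} resp P? = map′
  (λ (x , u , p) → x ∷ᵗ u , p)
  (λ (u , p) → u zero , u ∘ suc , resp (λ { zero → refl ; (suc i) → refl }) p)
  (any? λ x → anyTuple? (λ u≐v → resp (λ { zero → refl ; (suc i) → u≐v i })) (λ u → P? (x ∷ᵗ u)))

⟪_⟫ : ∀ {k} {P : Pred (Fin k) 0ℓ} → Decidable P → Subset k
⟪ P? ⟫ = Vec.tabulate (does ∘ P?)

module _ {k} {P : Pred (Fin k) 0ℓ} (P? : Decidable P) where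

  ∈⟪⟫⁺ : ∀ {x} → P x → x ∈ ⟪ P? ⟫
  ∈⟪⟫⁺ {x} px = lookup⇒[]= x _ (trans (lookup∘tabulate _ x) (dec-true (P? x) px))

  ∈⟪⟫⁻ : ∀ {x} → x ∈ ⟪ P? ⟫ → P x
  ∈⟪⟫⁻ {x} x∈ with P? x | trans (sym (lookup∘tabulate (does ∘ P?) x)) ([]=⇒lookup x∈)
  ... | yes px | _ = px
  ... | no _   | ()

total : ∀ {m} → (Fin m → ℕ) → ℕ
total {zero}  f = 0
total {suc m} f = f zero + total (f ∘ suc)

total-mono-≤ : ∀ {m} {f g : Fin m → ℕ} → (∀ i → f i ≤ g i) → total f ≤ total g
total-mono-≤ {zero}  f≤g = z≤n
total-mono-≤ {suc m} f≤g = +-mono-≤ (f≤g zero) (total-mono-≤ (f≤g ∘ suc))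

total-mono-< : ∀ {m} {f g : Fin m → ℕ} → (∀ i → f i ≤ g i) → ∀ j → f j < g j → total f < total g
total-mono-< f≤g zero    f<g = +-mono-<-≤ f<g (total-mono-≤ (f≤g ∘ suc))
total-mono-< f≤g (suc j) f<g = +-mono-≤-< (f≤g zero) (total-mono-< (f≤g ∘ suc) j f<g)

lookup-injective : ∀ {xs : List ℕ} → UniqueList xs → ∀ {i j} →
  List.lookup xs i ≡ List.lookup xs j → i ≡ j
lookup-injective (x∉ ∷ u) {zero}  {zero}  eq = refl
lookup-injective (x∉ ∷ u) {zero}  {suc j} eq = contradiction eq (All.lookup x∉ (∈-lookup j))
lookup-injective (x∉ ∷ u) {suc i} {zero}  eq = contradiction (sym eq) (All.lookup x∉ (∈-lookup i))
lookup-injective (x∉ ∷ u) {suc i} {suc j} eq = cong suc (lookup-injective u eq)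

-- Blocks are indexed by positions in the duplicate-free list of attained colours: attained makes
-- them nonempty, duplicate-free makes them disjoint.
module Fibres {k} (κ : Fin k → ℕ) where

  colours : List ℕ
  colours = deduplicate ℕ._≟_ (List.tabulate κ)

  colour : Fin (List.length colours) → ℕ
  colour = List.lookup colours

  fibre : Fin (List.length colours) → Subset k
  fibre b = ⟪ (λ x → κ x ℕ.≟ colour b) ⟫

  fibre⁻ : ∀ {b x} → x ∈ fibre b → κ x ≡ colour b
  fibre⁻ {b} = ∈⟪⟫⁻ λ x → κ x ℕ.≟ colour b

  fibre⁺ : ∀ {b x} → κ x ≡ colour b → x ∈ fibre b
  fibre⁺ {b} = ∈⟪⟫⁺ λ x → κ x ℕ.≟ colour b

  fibres : Partition k
  fibres = record
    { block    = fibre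
    ; nonempty = λ b → map₂ (fibre⁺ ∘ sym) (∈-tabulate⁻ (∈-deduplicate⁻ ℕ._≟_ (List.tabulate κ) (∈-lookup b)))
    ; disjoint = λ x∈a x∈b → lookup-injective (deduplicate-! ℕ._≟_ (List.tabulate κ))
                                (trans (sym (fibre⁻ x∈a)) (fibre⁻ x∈b))
    ; covering = λ x → let κx∈ = ∈-deduplicate⁺ ℕ._≟_ (∈-tabulate⁺ {f = κ} x)
                       in index κx∈ , fibre⁺ (lookup-index κx∈)
    }

module _ {m} {n : Fin m → ℕ} where

  Family : Set
  Family = ∀ i → Subset (n i)

  -- A colouring of the whole factor partitions each of its subsets at once, so a family can shrink
  -- while the colouring stays fixed.
  Colouring : Set
  Colouring = ∀ i → Fin (n i) → ℕ

  SameColour : Colouring → Rel (Tuple n) 0ℓ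
  SameColour κ u v = ∀ i → κ i (u i) ≡ κ i (v i)

  -- A box is named by a point `a` in it, so every box considered meets the product of the `A i`.
  ShatteredIn : Pred (Tuple n) 0ℓ → Family → Colouring → Set
  ShatteredIn S A κ = ∀ a → Product A a → ∃ λ s → Product A s × S s × SameColour κ s a

  -- A copy of the minor-subproduct of colour classes inside A, given by the
  -- choice of a representative in each class.
  record CopyIn (S : Pred (Tuple n) 0ℓ) (A : Family) (κ : Colouring) : Set where
    field
      rep        : ∀ i → Fin (n i) → Fin (n i)
      rep∈       : ∀ {i x} → x ∈ A i → rep i x ∈ A i
      rep-colour : ∀ {i x} → x ∈ A i → κ i (rep i x) ≡ κ i x
      rep-cong   : ∀ {i x y} → x ∈ A i → y ∈ A i → κ i x ≡ κ i y → rep i x ≡ rep i y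
      rep⊆       : ∀ a → Product A a → S (λ i → rep i (a i))

  AmpleIn : Pred (Tuple n) 0ℓ → Family → Set
  AmpleIn S A = ∀ κ → ShatteredIn S A κ → CopyIn S A κ

  module _ {S : Pred (Tuple n) 0ℓ} {A : Family} (full : ∀ i x → x ∈ A i) where

    -- The blocks are the colour classes, and `rep` sends an element to the one that the copy has in
    -- its class.
    ample⇒ampleIn : Ample S → AmpleIn S A
    ample⇒ampleIn ample κ shattered = record
      { rep        = λ i x → proj₁ (copy i (β i x))
      ; rep∈       = λ _ → full _ _
      ; rep-colour = λ {i} {x} _ → trans (F.fibre⁻ i (proj₂ (proj₁ (proj₂ (copy i (β i x))))))
                                         (sym (F.fibre⁻ i (∈β i x)))
      ; rep-cong   = λ {i} {x} {y} _ _ eq → cong (λ b → proj₁ (copy i b)) (disjoint (Λ i) {x = x} (∈β i x)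
                       (F.fibre⁺ i (trans eq (F.fibre⁻ i (∈β i y)))))
      ; rep⊆       = λ a _ → W⊆S λ i → proj₁ (proj₁ (proj₂ (copy i (β i (a i)))))
      }
      where
      module F (i : Fin m) = Fibres (κ i)
      Λ : GeneralizedPartition
      Λ i = F.fibres i
      β : ∀ i → Fin (n i) → Fin (size (Λ i))
      β i x = proj₁ (covering (Λ i) x)
      ∈β : ∀ i x → x ∈ block (Λ i) (β i x)
      ∈β i x = proj₂ (covering (Λ i) x)
      strong : StronglyShattered Λ S
      strong = ample Λ λ P →
        let a = λ i → proj₁ (nonempty (Λ i) (P i))
            s , _ , s∈S , same = shattered a (λ i → full i (a i))
        in s , s∈S , λ i → F.fibre⁺ i (trans (same i) (F.fibre⁻ i (proj₂ (nonempty (Λ i) (P i)))))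
      copy : IsCopy Λ (proj₁ strong)
      copy = proj₁ (proj₂ strong)
      W⊆S : ∀ {u} → Product (proj₁ strong) u → S u
      W⊆S = proj₂ (proj₂ strong)

    -- Elements are coloured by the number of their block.
    ampleIn⇒ample : S Respects _≐_ → AmpleIn S A → Ample S
    ampleIn⇒ample resp ample Λ shattered = W , isCopy , λ u∈W → resp (λ i → ∈⟪⟫⁻ (fixed? i) (u∈W i)) (rep⊆ _ (λ i → full i _))
      where
      β : ∀ i → Fin (n i) → Fin (size (Λ i))
      β i x = proj₁ (covering (Λ i) x)
      ∈β : ∀ i x → x ∈ block (Λ i) (β i x)
      ∈β i x = proj₂ (covering (Λ i) x)
      κ : Colouring
      κ i x = toℕ (β i x)
      κ-cong : ∀ {i b x y} → x ∈ block (Λ i) b → y ∈ block (Λ i) b → κ i x ≡ κ i y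
      κ-cong {i} x∈ y∈ = cong toℕ (trans (disjoint (Λ i) (∈β i _) x∈) (disjoint (Λ i) y∈ (∈β i _)))
      shatteredIn : ShatteredIn S A κ
      shatteredIn a _ =
        let s , s∈S , s∈P = shattered (λ i → β i (a i))
        in s , (λ i → full i (s i)) , s∈S , λ i → κ-cong (s∈P i) (∈β i (a i))
      open CopyIn (ample κ shatteredIn)
      fixed? : ∀ i (x : Fin (n i)) → Dec (rep i x ≡ x)
      fixed? i x = rep i x Fin.≟ x
      -- `rep` preserves colours, hence is idempotent, and its image is described decidably as the
      -- set of its fixed points.
      W : Family
      W i = ⟪ fixed? i ⟫
      isCopy : IsCopy Λ W
      isCopy i b =
        let x , x∈ = nonempty (Λ i) b
            same = rep-colour (full i x)
        in rep i x
         , ( ∈⟪⟫⁺ (fixed? i) (rep-cong (full i _) (full i _) same)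
           , subst (λ c → rep i x ∈ block (Λ i) c)
               (trans (toℕ-injective same) (disjoint (Λ i) (∈β i x) x∈)) (∈β i (rep i x)))
         , λ (y∈W , y∈) → trans (rep-cong (full i _) (full i _) (κ-cong x∈ y∈)) (∈⟪⟫⁻ (fixed? i) y∈W)

  -- Restriction of ample sets to subproducts

  module _ {S : Pred (Tuple n) 0ℓ} where

    -- Elements of A outside A′ are put first in the colour class of the given
    -- point x₀ and, if the copy obtained uses one of them, next in a class of
    -- their own: the first copy shows that the latter is shattered as well.
    restrict-at : ∀ {A A′ : Family} i → (∀ j → A′ j ⊆ˢ A j) → (∀ j → j ≢ i → A j ⊆ˢ A′ j) →
      ∀ x₀ → Product A′ x₀ → AmpleIn S A → AmpleIn S A′
    restrict-at {A} {A′} i A′⊆A A⊆A′ x₀ x₀∈ ample κ shattered = result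
      where
      clip : ∀ j → Fin (n j) → Fin (n j)
      clip j x = if does (x ∈? A′ j) then x else x₀ j

      clip-in : ∀ {j x} → x ∈ A′ j → clip j x ≡ x
      clip-in {j} {x} x∈ rewrite dec-true (x ∈? A′ j) x∈ = refl

      clip-out : ∀ {j x} → x ∉ A′ j → clip j x ≡ x₀ j
      clip-out {j} {x} x∉ rewrite dec-false (x ∈? A′ j) x∉ = refl

      clip∈ : ∀ j x → clip j x ∈ A′ j
      clip∈ j x with x ∈? A′ j
      ... | yes x∈ = x∈
      ... | no _   = x₀∈ j

      -- The successor in `κ₂` reserves colour 0 for the elements outside `A′`.
      κ₁ κ₂ : Colouring
      κ₁ j x = κ j (clip j x)
      κ₂ j x = if does (x ∈? A′ j) then suc (κ j x) else 0

      κ₂-in : ∀ {j x} → x ∈ A′ j → κ₂ j x ≡ suc (κ j x)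
      κ₂-in {j} {x} x∈ rewrite dec-true (x ∈? A′ j) x∈ = refl

      κ₂-out : ∀ {j x} → x ∉ A′ j → κ₂ j x ≡ 0
      κ₂-out {j} {x} x∉ rewrite dec-false (x ∈? A′ j) x∉ = refl

      shattered₁ : ShatteredIn S A κ₁
      shattered₁ a _ =
        let s , s∈ , s∈S , same = shattered (λ j → clip j (a j)) (λ j → clip∈ j (a j))
        in s , (λ j → A′⊆A j (s∈ j)) , s∈S , λ j → trans (cong (κ j) (clip-in (s∈ j))) (same j)

      module C₁ = CopyIn (ample κ₁ shattered₁)

      rep₁≢ : ∀ {j x} → j ≢ i → x ∈ A′ j → C₁.rep j x ∈ A′ j
      rep₁≢ {j} j≢i x∈ = A⊆A′ j j≢i (C₁.rep∈ (A′⊆A j x∈))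

      module _ (rep₁x₀∈ : C₁.rep i (x₀ i) ∈ A′ i) where

        rep₁∈ : ∀ {j x} → x ∈ A′ j → C₁.rep j x ∈ A′ j
        rep₁∈ {j} {x} x∈ with C₁.rep j x ∈? A′ j | j Fin.≟ i
        ... | yes r∈ | _        = r∈
        ... | no r∉  | no j≢i   = rep₁≢ j≢i x∈
        -- A representative outside `A′` has the colour of `x₀ j`, so it is the representative of
        -- `x₀ j`, which was assumed to lie in `A′`.
        ... | no r∉  | yes refl = subst (_∈ A′ j) (sym (C₁.rep-cong (A′⊆A j x∈) (A′⊆A j (x₀∈ j)) κ₁x≡κ₁x₀)) rep₁x₀∈
          where
          κ₁x≡κ₁x₀ : κ₁ j x ≡ κ₁ j (x₀ j)
          κ₁x≡κ₁x₀ = trans (sym (C₁.rep-colour (A′⊆A j x∈)))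
            (trans (cong (κ j) (clip-out r∉)) (cong (κ j) (sym (clip-in (x₀∈ j)))))

        inside : CopyIn S A′ κ
        inside = record
          { rep        = C₁.rep
          ; rep∈       = rep₁∈
          ; rep-colour = λ {j} x∈ → trans (cong (κ j) (sym (clip-in (rep₁∈ x∈))))
                           (trans (C₁.rep-colour (A′⊆A j x∈)) (cong (κ j) (clip-in x∈)))
          ; rep-cong   = λ {j} x∈ y∈ eq → C₁.rep-cong (A′⊆A j x∈) (A′⊆A j y∈)
                           (trans (cong (κ j) (clip-in x∈)) (trans eq (cong (κ j) (sym (clip-in y∈)))))
          ; rep⊆       = λ a a∈ → C₁.rep⊆ a (λ j → A′⊆A j (a∈ j))
          }

      module _ (rep₁x₀∉ : C₁.rep i (x₀ i) ∉ A′ i) where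

        shattered₂ : ShatteredIn S A κ₂
        shattered₂ a a∈ with a i ∈? A′ i
        ... | yes aᵢ∈ =
          let a∈′ : Product A′ a
              a∈′ j = [ (λ { refl → aᵢ∈ }) , (λ j≢i → A⊆A′ j j≢i (a∈ j)) ]′ (toSum (j Fin.≟ i))
              s , s∈ , s∈S , same = shattered a a∈′
          in s , (λ j → A′⊆A j (s∈ j)) , s∈S
           , λ j → trans (κ₂-in (s∈ j)) (trans (cong suc (same j)) (sym (κ₂-in (a∈′ j))))
        -- The i-th coordinate sought lies outside `A′`. The first copy provides it, since it
        -- represents the class of `x₀ i` by such an element.
        ... | no aᵢ∉ =
            (λ j → C₁.rep j (clip j (a j)))
          , (λ j → C₁.rep∈ (A′⊆A j (clip∈ j (a j))))
          , C₁.rep⊆ _ (λ j → A′⊆A j (clip∈ j (a j)))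
          , same
          where
          same : ∀ j → κ₂ j (C₁.rep j (clip j (a j))) ≡ κ₂ j (a j)
          same j with j Fin.≟ i
          ... | yes refl = trans (cong (κ₂ j) (cong (C₁.rep j) (clip-out aᵢ∉)))
                             (trans (κ₂-out rep₁x₀∉) (sym (κ₂-out aᵢ∉)))
          ... | no j≢i = begin
            κ₂ j (C₁.rep j (clip j (a j)))          ≡⟨ κ₂-in r∈ ⟩
            suc (κ j (C₁.rep j (clip j (a j))))     ≡⟨ cong (suc ∘ κ j) (clip-in r∈) ⟨
            suc (κ₁ j (C₁.rep j (clip j (a j))))    ≡⟨ cong suc (C₁.rep-colour (A′⊆A j (clip∈ j (a j)))) ⟩
            suc (κ j (clip j (clip j (a j))))       ≡⟨ cong (suc ∘ κ j) (clip-in (clip∈ j (a j))) ⟩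
            suc (κ j (clip j (a j)))                ≡⟨ cong (suc ∘ κ j) (clip-in aⱼ∈) ⟩
            suc (κ j (a j))                         ≡⟨ κ₂-in aⱼ∈ ⟨
            κ₂ j (a j)                              ∎
            where
            open ≡-Reasoning
            r∈ = rep₁≢ j≢i (clip∈ j (a j))
            aⱼ∈ = A⊆A′ j j≢i (a∈ j)

        outside-class : CopyIn S A′ κ
        outside-class = record
          { rep        = C₂.rep
          ; rep∈       = rep₂∈
          ; rep-colour = λ {j} x∈ → suc-injective (trans (sym (κ₂-in (rep₂∈ x∈)))
                           (trans (C₂.rep-colour (A′⊆A j x∈)) (κ₂-in x∈)))
          ; rep-cong   = λ {j} x∈ y∈ eq → C₂.rep-cong (A′⊆A j x∈) (A′⊆A j y∈)
                           (trans (κ₂-in x∈) (trans (cong suc eq) (sym (κ₂-in y∈))))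
          ; rep⊆       = λ a a∈ → C₂.rep⊆ a (λ j → A′⊆A j (a∈ j))
          }
          where
          module C₂ = CopyIn (ample κ₂ shattered₂)
          rep₂∈ : ∀ {j x} → x ∈ A′ j → C₂.rep j x ∈ A′ j
          rep₂∈ {j} {x} x∈ with C₂.rep j x ∈? A′ j
          ... | yes r∈ = r∈
          ... | no r∉  = contradiction
            (trans (sym (κ₂-out r∉)) (trans (C₂.rep-colour (A′⊆A j x∈)) (κ₂-in x∈))) λ ()

      result : CopyIn S A′ κ
      result with C₁.rep i (x₀ i) ∈? A′ i
      ... | yes r∈ = inside r∈
      ... | no r∉  = outside-class r∉

    -- `go k` treats families that are full from coordinate k on. It fills up coordinate k - 1,
    -- recurses, and cuts that coordinate back with `restrict-at`.
    ample⇒ampleIn-all : Ample S → ∀ A x₀ → Product A x₀ → AmpleIn S A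
    ample⇒ampleIn-all ample A x₀ x₀∈ = go m A x₀∈ λ j m≤j → contradiction m≤j (<⇒≱ (toℕ<n j))
      where
      go : ∀ k A → Product A x₀ → (∀ j → k ≤ toℕ j → ∀ x → x ∈ A j) → AmpleIn S A
      go zero    A x₀∈ full = ample⇒ampleIn (λ j → full j z≤n) ample
      go (suc k) A x₀∈ full with k ℕ.<? m
      ... | no k≮m = go k A x₀∈ λ j k≤j → contradiction (≤-<-trans k≤j (toℕ<n j)) k≮m
      ... | yes k<m = restrict-at i (λ j x∈ → A⊆A⁺ j x∈) A⁺⊆A x₀ x₀∈
          (go k A⁺ (λ j → A⊆A⁺ j (x₀∈ j)) full⁺)
        where
        i = fromℕ< k<m
        A⁺ : Family
        A⁺ j = if does (j Fin.≟ i) then ⊤ else A j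
        A⊆A⁺ : ∀ j {x} → x ∈ A j → x ∈ A⁺ j
        A⊆A⁺ j x∈ with j Fin.≟ i
        ... | yes _ = ∈⊤
        ... | no _  = x∈
        A⁺⊆A : ∀ j → j ≢ i → A⁺ j ⊆ˢ A j
        A⁺⊆A j j≢i x∈ rewrite dec-false (j Fin.≟ i) j≢i = x∈
        full⁺ : ∀ j → k ≤ toℕ j → ∀ x → x ∈ A⁺ j
        full⁺ j k≤j x with j Fin.≟ i
        ... | yes _   = ∈⊤
        ... | no j≢i = full j (≤∧≢⇒< k≤j λ k≡j → j≢i (toℕ-injective (trans (sym k≡j) (sym (toℕ-fromℕ< k<m))))) x

  -- The exchange property

  Between : Tuple n → Tuple n → Tuple n → Set
  Between p q u = ∀ k → u k ≡ p k ⊎ u k ≡ q k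

  FullCube : Pred (Tuple n) 0ℓ → Rel (Tuple n) 0ℓ
  FullCube S p q = ∀ u → Between p q u → S u

  -- Corresponding antipodes are listed in the same order, so in a common direction both cubes run
  -- between the same two values.
  Parallel : (p q p′ q′ : Tuple n) → Set
  Parallel p q p′ q′ = ∀ k → (p k ≡ q k × p′ k ≡ q′ k) ⊎ (p k ≡ p′ k × q k ≡ q′ k)

  -- Where both cubes are constant, the new cube may follow either of them; in a common direction of
  -- parallel cubes the two alternatives coincide.
  Joins : (i : Fin m) (p q p′ q′ r r′ : Tuple n) → Set
  Joins i p q p′ q′ r r′ = ∀ k →
    (k ≡ i × r k ≡ p k × r′ k ≡ p′ k) ⊎
    (k ≢ i × ((r k ≡ p k × r′ k ≡ q k) ⊎ (r k ≡ p′ k × r′ k ≡ q′ k)))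

  Exchange : Pred (Tuple n) 0ℓ → Set
  Exchange S = ∀ p q p′ q′ → FullCube S p q → FullCube S p′ q′ → Parallel p q p′ q′ →
    ∀ i → p i ≢ p′ i → ∃₂ λ r r′ → FullCube S r r′ × Joins i p q p′ q′ r r′

  module _ {S : Pred (Tuple n) 0ℓ} (resp : S Respects _≐_) where

    -- In the product of the values taken by the four antipodes, all values are kept apart in
    -- direction i and in the directions of the cubes, and identified elsewhere. The two given cubes
    -- shatter it, and a copy inside it is the cube sought.
    ample⇒exchange : Ample S → Exchange S
    ample⇒exchange ample p q p′ q′ pq⊆S p′q′⊆S par i pᵢ≢p′ᵢ = r , r′ , full , joins
      where
      corner? : ∀ k (x : Fin (n k)) → Dec ((x ≡ p k ⊎ x ≡ q k) ⊎ (x ≡ p′ k ⊎ x ≡ q′ k))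
      corner? k x = (x Fin.≟ p k ⊎-dec x Fin.≟ q k) ⊎-dec (x Fin.≟ p′ k ⊎-dec x Fin.≟ q′ k)

      A : Family
      A k = ⟪ corner? k ⟫

      p∈ : Product A p
      p∈ k = ∈⟪⟫⁺ (corner? k) (inj₁ (inj₁ refl))
      q∈ : Product A q
      q∈ k = ∈⟪⟫⁺ (corner? k) (inj₁ (inj₂ refl))
      p′∈ : Product A p′
      p′∈ k = ∈⟪⟫⁺ (corner? k) (inj₂ (inj₁ refl))

      free? : ∀ k → Dec (k ≡ i ⊎ p k ≢ q k)
      free? k = k Fin.≟ i ⊎-dec ¬? (p k Fin.≟ q k)

      κ : Colouring
      κ k x = if does (free? k) then toℕ x else 0

      κ-inj : ∀ {k x y} → k ≡ i ⊎ p k ≢ q k → κ k x ≡ κ k y → x ≡ y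
      κ-inj {k} {x} {y} fr eq = toℕ-injective (subst (λ b → (if b then toℕ x else 0) ≡ (if b then toℕ y else 0))
        (dec-true (free? k) fr) eq)

      pᵢ≡qᵢ : p i ≡ q i
      pᵢ≡qᵢ with par i
      ... | inj₁ (eq , _) = eq
      ... | inj₂ (eq , _) = contradiction eq pᵢ≢p′ᵢ

      corner : ∀ {a} → Product A a → ∀ k → p k ≢ q k → a k ≡ p k ⊎ a k ≡ q k
      corner a∈ k p≢q with par k | ∈⟪⟫⁻ (corner? k) (a∈ k)
      ... | inj₁ (p≡q , _)    | _              = contradiction p≡q p≢q
      ... | inj₂ _            | inj₁ a≡        = a≡
      ... | inj₂ (p≡ , q≡)    | inj₂ (inj₁ a≡) = inj₁ (trans a≡ (sym p≡))
      ... | inj₂ (p≡ , q≡)    | inj₂ (inj₂ a≡) = inj₂ (trans a≡ (sym q≡))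

      move : Tuple n → Tuple n → Tuple n
      move base a k = if does (free? k) then a k else base k

      move-free : ∀ base a {k} → k ≡ i ⊎ p k ≢ q k → move base a k ≡ a k
      move-free base a {k} fr = cong (λ b → if b then a k else base k) (dec-true (free? k) fr)

      move-fixed : ∀ base a {k} → ¬ (k ≡ i ⊎ p k ≢ q k) → move base a k ≡ base k
      move-fixed base a {k} ¬fr = cong (λ b → if b then a k else base k) (dec-false (free? k) ¬fr)

      move∈ : ∀ {base a} → Product A base → Product A a → Product A (move base a)
      move∈ base∈ a∈ k with does (free? k)
      ... | true  = a∈ k
      ... | false = base∈ k

      move-colour : ∀ base a → SameColour κ (move base a) a
      move-colour base a k with does (free? k)
      ... | true  = refl
      ... | false = refl

      shattered : ShatteredIn S A κ
      -- The i-th coordinate decides which cube supplies the point. The point follows `a` in the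
      -- free directions and `p` or `p′` elsewhere.
      shattered a a∈ with a i Fin.≟ p i
      ... | yes aᵢ≡pᵢ = move p a , move∈ p∈ a∈ , pq⊆S _ between , move-colour p a
        where
        between : Between p q (move p a)
        between k with free? k
        ... | no ¬fr = inj₁ (move-fixed p a ¬fr)
        ... | yes fr = subst (λ x → x ≡ p k ⊎ x ≡ q k) (sym (move-free p a fr)) (at fr)
          where
          at : k ≡ i ⊎ p k ≢ q k → a k ≡ p k ⊎ a k ≡ q k
          at (inj₁ refl) = inj₁ aᵢ≡pᵢ
          at (inj₂ p≢q)  = corner a∈ k p≢q
      ... | no aᵢ≢pᵢ = move p′ a , move∈ p′∈ a∈ , p′q′⊆S _ between , move-colour p′ a
        where
        between : Between p′ q′ (move p′ a)
        between k with free? k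
        ... | no ¬fr = inj₁ (move-fixed p′ a ¬fr)
        ... | yes fr = subst (λ x → x ≡ p′ k ⊎ x ≡ q′ k) (sym (move-free p′ a fr)) (at fr)
          where
          at : k ≡ i ⊎ p k ≢ q k → a k ≡ p′ k ⊎ a k ≡ q′ k
          at (inj₁ refl) with ∈⟪⟫⁻ (corner? k) (a∈ k)
          ... | inj₁ (inj₁ a≡) = contradiction a≡ aᵢ≢pᵢ
          ... | inj₁ (inj₂ a≡) = contradiction (trans a≡ (sym pᵢ≡qᵢ)) aᵢ≢pᵢ
          ... | inj₂ a≡        = a≡
          at (inj₂ p≢q) with par k
          ... | inj₁ (p≡q , _) = contradiction p≡q p≢q
          ... | inj₂ (p≡ , q≡) = Sum.map (λ a≡ → trans a≡ p≡) (λ a≡ → trans a≡ q≡) (corner a∈ k p≢q)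

      open CopyIn (ample⇒ampleIn-all ample A p p∈ κ shattered)

      -- Together with `p` this names opposite colours in every free direction, so the
      -- representatives of the two are antipodes of the copy.
      other : Tuple n
      other k = if does (k Fin.≟ i) then p′ k else q k

      other∈ : Product A other
      other∈ k with does (k Fin.≟ i)
      ... | true  = p′∈ k
      ... | false = q∈ k

      r r′ : Tuple n
      r  k = rep k (p k)
      r′ k = rep k (other k)

      full : FullCube S r r′
      full u u∈ = subst-rep (λ k → choose k (u∈ k))
        where
        choose : ∀ k → u k ≡ r k ⊎ u k ≡ r′ k → ∃ λ x → x ∈ A k × u k ≡ rep k x
        choose k (inj₁ eq) = p k , p∈ k , eq
        choose k (inj₂ eq) = other k , other∈ k , eq
        subst-rep : (∀ k → ∃ λ x → x ∈ A k × u k ≡ rep k x) → S u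
        subst-rep f = resp (λ k → sym (proj₂ (proj₂ (f k)))) (rep⊆ (λ k → proj₁ (f k)) (λ k → proj₁ (proj₂ (f k))))

      joins : Joins i p q p′ q′ r r′
      joins k with k Fin.≟ i
      ... | yes refl = inj₁ (refl , κ-inj (inj₁ refl) (rep-colour (p∈ k)) , κ-inj (inj₁ refl) (rep-colour (p′∈ k)))
      ... | no k≢i with p k Fin.≟ q k
      ...   | no p≢q  = inj₂ (k≢i , inj₁ (κ-inj (inj₂ p≢q) (rep-colour (p∈ k)) , κ-inj (inj₂ p≢q) (rep-colour (q∈ k))))
      ...   | yes p≡q = inj₂ (k≢i , pair (∈⟪⟫⁻ (corner? k) (rep∈ (p∈ k))))
        where
        rq≡rp : rep k (q k) ≡ rep k (p k)
        rq≡rp = cong (rep k) (sym p≡q)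
        p′≡q′ : p′ k ≡ q′ k
        p′≡q′ with par k
        ... | inj₁ (_ , eq)  = eq
        ... | inj₂ (p≡ , q≡) = trans (sym p≡) (trans p≡q q≡)
        pair : (rep k (p k) ≡ p k ⊎ rep k (p k) ≡ q k) ⊎ (rep k (p k) ≡ p′ k ⊎ rep k (p k) ≡ q′ k) →
          (rep k (p k) ≡ p k × rep k (q k) ≡ q k) ⊎ (rep k (p k) ≡ p′ k × rep k (q k) ≡ q′ k)
        pair (inj₁ (inj₁ eq)) = inj₁ (eq , trans rq≡rp (trans eq p≡q))
        pair (inj₁ (inj₂ eq)) = inj₁ (trans eq (sym p≡q) , trans rq≡rp eq)
        pair (inj₂ (inj₁ eq)) = inj₂ (eq , trans rq≡rp (trans eq p′≡q′))
        pair (inj₂ (inj₂ eq)) = inj₂ (trans eq (sym p′≡q′) , trans rq≡rp eq)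

    -- Copies in binary cubes

    module _ (exchange : Exchange S) {A : Family} {κ : Colouring}
      (α β : Tuple n) (α∈ : Product A α) (β∈ : Product A β)
      (only : ∀ j {x} → x ∈ A j → x ≡ α j ⊎ x ≡ β j)
      (shattered : ShatteredIn S A κ)
      where

      private
        -- State of coordinate j after k steps. Below k the cube runs from `α j` to `β j` if these
        -- differ in colour; otherwise it is constant, and from k on its value has the colour
        -- prescribed by `a`.
        Spans : ℕ → ∀ j → (a p q : Fin (n j)) → Set
        Spans k j a p q =
          (toℕ j < k × κ j (α j) ≢ κ j (β j) × p ≡ α j × q ≡ β j) ⊎
          (p ≡ q × p ∈ A j × (k ≤ toℕ j → κ j p ≡ κ j a) × (toℕ j < k → κ j (α j) ≡ κ j (β j)))

        spans-suc : ∀ {k j} {a b p q : Fin (n j)} → (toℕ j ≡ k → κ j (α j) ≡ κ j (β j)) →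
          (toℕ j ≢ k → b ≡ a) → Spans k j b p q → Spans (suc k) j a p q
        spans-suc at off (inj₁ (j<k , rest)) = inj₁ (m<n⇒m<1+n j<k , rest)
        spans-suc {k} {j} at off (inj₂ (p≡q , p∈ , late , early)) = inj₂ (p≡q , p∈
          , (λ k<j → trans (late (<⇒≤ k<j)) (cong (κ j) (off (>⇒≢ k<j))))
          , (λ j≤k → [ at , (λ j≢k → early (≤∧≢⇒< (s≤s⁻¹ j≤k) j≢k)) ]′ (toSum (toℕ j ℕ.≟ k))))

        same-colour⇒≡ : ∀ {j x y} → x ∈ A j → y ∈ A j → κ j (α j) ≢ κ j (β j) → κ j x ≡ κ j y → x ≡ y
        same-colour⇒≡ {j} x∈ y∈ κ≢ eq with only j x∈ | only j y∈
        ... | inj₁ refl | inj₁ refl = refl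
        ... | inj₁ refl | inj₂ refl = contradiction eq κ≢
        ... | inj₂ refl | inj₁ refl = contradiction (sym eq) κ≢
        ... | inj₂ refl | inj₂ refl = refl

        same-colour : ∀ {j x} → κ j (α j) ≡ κ j (β j) → x ∈ A j → κ j x ≡ κ j (α j)
        same-colour {j} κ≡ x∈ with only j x∈
        ... | inj₁ refl = refl
        ... | inj₂ refl = sym κ≡

        -- Shattering gives a point for every box, which is a cube of dimension 0. If coordinate k
        -- has two colours, the cubes for the boxes with `α` and with `β` put there are parallel,
        -- and the exchange property joins them.
        cubes : ∀ k a → Product A a → ∃₂ λ p q → FullCube S p q × ∀ j → Spans k j (a j) (p j) (q j)
        cubes zero a a∈ =
          let s , s∈ , s∈S , same = shattered a a∈
          in s , s , (λ u u∈ → resp (λ j → sym ([ id , id ]′ (u∈ j))) s∈S)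
           , λ j → inj₂ (refl , s∈ j , (λ _ → same j) , λ ())
        cubes (suc k) a a∈ with k ℕ.<? m
        ... | no k≮m =
          let p , q , full , spans = cubes k a a∈
          in p , q , full , λ j → spans-suc (λ j≡k → contradiction (subst (_< m) j≡k (toℕ<n j)) k≮m) (λ _ → refl) (spans j)
        ... | yes k<m with κ i (α i) ℕ.≟ κ i (β i)
          where i = fromℕ< k<m
        ... | yes κ≡ =
          let p , q , full , spans = cubes k a a∈
          in p , q , full , λ j → spans-suc
               (λ j≡k → subst (λ l → κ l (α l) ≡ κ l (β l)) (toℕ-injective (trans (toℕ-fromℕ< k<m) (sym j≡k))) κ≡)
               (λ _ → refl) (spans j)
        ... | no κ≢ = join (cubes k (put α) (put∈ α∈)) (cubes k (put β) (put∈ β∈))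
          where
          i = fromℕ< k<m

          i≮k : ¬ toℕ i < k
          i≮k i<k = <-irrefl (toℕ-fromℕ< k<m) i<k

          put : Tuple n → Tuple n
          put b j = if does (j Fin.≟ i) then b j else a j

          put-here : ∀ b → put b i ≡ b i
          put-here b = cong (λ c → if c then b i else a i) (dec-true (i Fin.≟ i) refl)

          put-other : ∀ b {j} → j ≢ i → put b j ≡ a j
          put-other b {j} j≢i = cong (λ c → if c then b j else a j) (dec-false (j Fin.≟ i) j≢i)

          put∈ : ∀ {b} → Product A b → Product A (put b)
          put∈ b∈ j with does (j Fin.≟ i)
          ... | true  = b∈ j
          ... | false = a∈ j

          value : ∀ {b} {p q : Fin (n i)} → Product A b → Spans k i (put b i) p q → p ≡ b i
          value b∈ (inj₁ (i<k , _)) = contradiction i<k i≮k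
          value {b} b∈ (inj₂ (_ , p∈ , late , _)) =
            same-colour⇒≡ p∈ (b∈ i) κ≢ (trans (late (≮⇒≥ i≮k)) (cong (κ i) (put-here b)))

          extend : ∀ b {j} {p q : Fin (n j)} → j ≢ i → Spans k j (put b j) p q → Spans (suc k) j (a j) p q
          extend b {j} j≢i = spans-suc
            (λ j≡k → contradiction (toℕ-injective (trans j≡k (sym (toℕ-fromℕ< k<m)))) j≢i)
            (λ _ → put-other b j≢i)

          join : (∃₂ λ p q → FullCube S p q × ∀ j → Spans k j (put α j) (p j) (q j)) →
            (∃₂ λ p q → FullCube S p q × ∀ j → Spans k j (put β j) (p j) (q j)) →
            ∃₂ λ p q → FullCube S p q × ∀ j → Spans (suc k) j (a j) (p j) (q j)
          join (p , q , full , spans) (p′ , q′ , full′ , spans′) =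
            let r , r′ , full″ , joins = exchange p q p′ q′ full full′ parallel i p≢p′
            in r , r′ , full″ , λ j → spans″ (joins j)
            where
            p≢p′ : p i ≢ p′ i
            p≢p′ eq = κ≢ (cong (κ i) (trans (sym (value {α} α∈ (spans i))) (trans eq (value {β} β∈ (spans′ i)))))

            parallel : Parallel p q p′ q′
            parallel j with spans j | spans′ j
            ... | inj₁ (_ , _ , p≡ , q≡)   | inj₁ (_ , _ , p′≡ , q′≡)  = inj₂ (trans p≡ (sym p′≡) , trans q≡ (sym q′≡))
            ... | inj₁ (j<k , κ≢′ , _)     | inj₂ (_ , _ , _ , early)  = contradiction (early j<k) κ≢′
            ... | inj₂ (_ , _ , _ , early) | inj₁ (j<k , κ≢′ , _)      = contradiction (early j<k) κ≢′
            ... | inj₂ (p≡q , _)           | inj₂ (p′≡q′ , _)          = inj₁ (p≡q , p′≡q′)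

            spans″ : ∀ {j} {x y : Fin (n j)} →
              (j ≡ i × x ≡ p j × y ≡ p′ j) ⊎ (j ≢ i × ((x ≡ p j × y ≡ q j) ⊎ (x ≡ p′ j × y ≡ q′ j))) →
              Spans (suc k) j (a j) x y
            spans″ (inj₁ (refl , refl , refl)) = inj₁
              (s≤s (≤-reflexive (toℕ-fromℕ< k<m)) , κ≢ , value {α} α∈ (spans i) , value {β} β∈ (spans′ i))
            spans″ {j} (inj₂ (j≢i , inj₁ (refl , refl))) = extend α j≢i (spans j)
            spans″ {j} (inj₂ (j≢i , inj₂ (refl , refl))) = extend β j≢i (spans′ j)

      binary-copy : CopyIn S A κ
      binary-copy = record
        { rep        = λ j x → pick j (κ j x)
        ; rep∈       = λ {j} {x} _ → pick∈ j (κ j x)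
        ; rep-colour = pick-colour
        ; rep-cong   = λ {j} _ _ → cong (pick j)
        ; rep⊆       = λ a _ → full _ λ j → pick-between j (κ j (a j))
        }
        where
        spanning : ∃₂ λ p q → FullCube S p q × ∀ j → Spans m j (α j) (p j) (q j)
        -- At stage m no coordinate is left whose colour the box prescribes, so any box will do.
        spanning = cubes m α α∈
        p q : Tuple n
        p = proj₁ spanning
        q = proj₁ (proj₂ spanning)
        full : FullCube S p q
        full = proj₁ (proj₂ (proj₂ spanning))
        spans : ∀ j → Spans m j (α j) (p j) (q j)
        spans = proj₂ (proj₂ (proj₂ spanning))

        -- As a function of the colour, the choice is constant on classes by construction. Every
        -- colour other than that of `p j` goes to `q j`.
        pick : ∀ j → ℕ → Fin (n j)
        pick j c with c ℕ.≟ κ j (p j)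
        ... | yes _ = p j
        ... | no _  = q j

        pick-between : ∀ j c → pick j c ≡ p j ⊎ pick j c ≡ q j
        pick-between j c with c ℕ.≟ κ j (p j)
        ... | yes _ = inj₁ refl
        ... | no _  = inj₂ refl

        p∈ : Product A p
        p∈ j with spans j
        ... | inj₁ (_ , _ , p≡ , _) = subst (_∈ A j) (sym p≡) (α∈ j)
        ... | inj₂ (_ , p∈ , _)     = p∈

        q∈ : Product A q
        q∈ j with spans j
        ... | inj₁ (_ , _ , _ , q≡) = subst (_∈ A j) (sym q≡) (β∈ j)
        ... | inj₂ (p≡q , p∈ , _)   = subst (_∈ A j) p≡q p∈

        pick∈ : ∀ j c → pick j c ∈ A j
        pick∈ j c with c ℕ.≟ κ j (p j)
        ... | yes _ = p∈ j
        ... | no _  = q∈ j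

        pick-colour : ∀ {j x} → x ∈ A j → κ j (pick j (κ j x)) ≡ κ j x
        pick-colour {j} {x} x∈ with κ j x ℕ.≟ κ j (p j) | spans j
        ... | yes eq | _ = sym eq
        ... | no κ≢p | inj₂ (p≡q , p∈ , _ , early) =
          contradiction (trans (same-colour (early (toℕ<n j)) x∈) (sym (same-colour (early (toℕ<n j)) p∈))) κ≢p
        ... | no κ≢p | inj₁ (_ , _ , p≡ , q≡) with only j x∈
        ...   | inj₁ refl = contradiction (cong (κ j) (sym p≡)) κ≢p
        ...   | inj₂ refl = cong (κ j) q≡

    -- Descent on the size of the product

    ∣_∣ᶠ : Family → ℕ
    ∣ A ∣ᶠ = total (λ i → ∣ A i ∣)

    shrinks : ∀ {A A′ : Family} → (∀ j → A′ j ⊆ˢ A j) → ∀ {i x} → x ∈ A i → x ∉ A′ i → ∣ A′ ∣ᶠ < ∣ A ∣ᶠ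
    shrinks A′⊆A {i} {x} x∈ x∉ =
      total-mono-< (λ j → p⊆q⇒∣p∣≤∣q∣ (A′⊆A j)) i (p⊂q⇒∣p∣<∣q∣ (A′⊆A i , x , x∈ , x∉))

    -- The colour-preserving map `f` into `A′` shows that `A′` still meets every class of `A`, so a
    -- copy in the smaller family serves for the larger one.
    extend-copy : ∀ {A A′ : Family} {κ} → (∀ j → A′ j ⊆ˢ A j) → (f : ∀ j → Fin (n j) → Fin (n j)) →
      (∀ j {x} → x ∈ A j → f j x ∈ A′ j) → (∀ j {x} → x ∈ A j → κ j (f j x) ≡ κ j x) →
      CopyIn S A′ κ → CopyIn S A κ
    extend-copy A′⊆A f f∈ f-colour C = record
      { rep        = λ j x → rep j (f j x)
      ; rep∈       = λ {j} x∈ → A′⊆A j (rep∈ (f∈ j x∈))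
      ; rep-colour = λ {j} x∈ → trans (rep-colour (f∈ j x∈)) (f-colour j x∈)
      ; rep-cong   = λ {j} x∈ y∈ eq → rep-cong (f∈ j x∈) (f∈ j y∈) (trans (f-colour j x∈) (trans eq (sym (f-colour j y∈))))
      ; rep⊆       = λ a a∈ → rep⊆ _ λ j → f∈ j (a∈ j)
      }
      where open CopyIn C

    -- `smaller` is the induction hypothesis: each time a smaller shattered family turns up, a copy
    -- in it is available.
    module Descent (S? : Decidable S) (exchange : Exchange S) {A : Family} {κ : Colouring}
      (shattered : ShatteredIn S A κ)
      (smaller : ∀ A′ → ∣ A′ ∣ᶠ < ∣ A ∣ᶠ → ShatteredIn S A′ κ → CopyIn S A′ κ)
      where

      -- The box of a is the reason why x cannot be removed from A i.
      record Blocking i (x : Fin (n i)) (a : Tuple n) : Set where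
        field
          a∈     : Product A a
          colour : κ i (a i) ≡ κ i x
          forced : ∀ {s} → Product A s → S s → SameColour κ s a → s i ≡ x

      open Blocking

      Twins : ∀ i → Rel (Fin (n i)) 0ℓ
      Twins i x y = x ∈ A i × y ∈ A i × x ≢ y × κ i x ≡ κ i y

      Avoids : ∀ i → Fin (n i) → Rel (Tuple n) 0ℓ
      Avoids i x a s = Product A s × S s × SameColour κ s a × s i ≢ x

      product? : Decidable (Product A)
      product? s = all? λ j → s j ∈? A j

      avoids? : ∀ i x a → Dec (∃ (Avoids i x a))
      avoids? i x a = anyTuple?
        (λ s≐t (s∈ , s∈S , same , sᵢ≢x) →
          (λ j → subst (_∈ A j) (s≐t j) (s∈ j)) , resp s≐t s∈S ,
          (λ j → trans (cong (κ j) (sym (s≐t j))) (same j)) , λ tᵢ≡x → sᵢ≢x (trans (s≐t i) tᵢ≡x))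
        (λ s → product? s ×-dec S? s ×-dec all? (λ j → κ j (s j) ℕ.≟ κ j (a j)) ×-dec ¬? (s i Fin.≟ x))

      blocked? : ∀ i x → Dec (∃ λ a → Product A a × κ i (a i) ≡ κ i x × ¬ ∃ (Avoids i x a))
      blocked? i x = anyTuple?
        (λ a≐b (a∈ , colour , none) →
          (λ j → subst (_∈ A j) (a≐b j) (a∈ j)) , trans (cong (κ i) (sym (a≐b i))) colour ,
          λ (s , s∈ , s∈S , same , sᵢ≢x) → none (s , s∈ , s∈S , (λ j → trans (same j) (cong (κ j) (sym (a≐b j)))) , sᵢ≢x))
        (λ a → product? a ×-dec κ i (a i) ℕ.≟ κ i x ×-dec ¬? (avoids? i x a))

      -- Every box is met by a point avoiding x in coordinate i, so the family without x is still
      -- shattered. The twin y keeps the class of x inhabited and takes the place of x.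
      remove : ∀ {i x y} → Twins i x y → ¬ (∃ λ a → Product A a × κ i (a i) ≡ κ i x × ¬ ∃ (Avoids i x a)) → CopyIn S A κ
      remove {i} {x} {y} (x∈ , y∈ , x≢y , κx≡κy) unblocked =
        extend-copy A′⊆A redirect redirect∈ redirect-colour
          (smaller A′ (shrinks A′⊆A x∈ λ x∈′ → proj₂ (∈⟪⟫⁻ (kept? i) x∈′) refl) shattered′)
        where
        -- Pairs are compared because the type of `z` depends on `j`.
        is-x? : ∀ j z → Dec ((j , z) ≡ (i , x))
        is-x? j z = ≡-dec Fin._≟_ Fin._≟_ (j , z) (i , x)
        kept? : ∀ j z → Dec (z ∈ A j × (j , z) ≢ (i , x))
        kept? j z = z ∈? A j ×-dec ¬? (is-x? j z)
        A′ : Family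
        A′ j = ⟪ kept? j ⟫
        A′⊆A : ∀ j → A′ j ⊆ˢ A j
        A′⊆A j z∈ = proj₁ (∈⟪⟫⁻ (kept? j) z∈)
        keep : ∀ {s} → Product A s → s i ≢ x → Product A′ s
        keep s∈ sᵢ≢x j = ∈⟪⟫⁺ (kept? j) (s∈ j , λ { refl → sᵢ≢x refl })
        shattered′ : ShatteredIn S A′ κ
        shattered′ a a∈′ with κ i (a i) ℕ.≟ κ i x
        ... | yes same =
          let s , s∈ , s∈S , col , sᵢ≢x = decidable-stable (avoids? i x a)
                (λ none → unblocked (a , (λ j → A′⊆A j (a∈′ j)) , same , none))
          in s , keep s∈ sᵢ≢x , s∈S , col
        ... | no other =
          let s , s∈ , s∈S , col = shattered a (λ j → A′⊆A j (a∈′ j))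
          in s , keep s∈ (λ sᵢ≡x → other (trans (sym (col i)) (cong (κ i) sᵢ≡x))) , s∈S , col
        redirect : ∀ j → Fin (n j) → Fin (n j)
        redirect j z with is-x? j z
        ... | yes refl = y
        ... | no _     = z
        redirect∈ : ∀ j {z} → z ∈ A j → redirect j z ∈ A′ j
        redirect∈ j {z} z∈ with is-x? j z
        ... | yes refl = ∈⟪⟫⁺ (kept? i) (y∈ , λ { refl → x≢y refl })
        ... | no z≢x   = ∈⟪⟫⁺ (kept? j) (z∈ , z≢x)
        redirect-colour : ∀ j {z} → z ∈ A j → κ j (redirect j z) ≡ κ j z
        redirect-colour j {z} z∈ with is-x? j z
        ... | yes refl = sym κx≡κy
        ... | no _     = refl

      -- Either x can be removed, which yields the copy at once, or a box blocking x is handed to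
      -- the continuation.
      block-or-copy : ∀ {i x y} → Twins i x y → (∀ a → Blocking i x a → CopyIn S A κ) → CopyIn S A κ
      block-or-copy {i} {x} twins use with blocked? i x
      ... | no unblocked = remove twins unblocked
      ... | yes (a , a∈ , colour , none) = use a record
        { a∈     = a∈
        ; colour = colour
        ; forced = λ {s} s∈ s∈S same → decidable-stable (s i Fin.≟ x) λ sᵢ≢x → none (s , s∈ , s∈S , same , sᵢ≢x)
        }

      -- If some y had neither colour, a copy inside the classes of a and b
      -- would have to contain both x and x′, which have the same colour.
      two-colours : ∀ {i x x′ a b} → Twins i x x′ → Blocking i x a → Blocking i x′ b →
        ∀ j {y} → y ∈ A j → κ j y ≡ κ j (a j) ⊎ κ j y ≡ κ j (b j)
      two-colours {i} {x} {x′} {a} {b} (_ , _ , x≢x′ , κx≡κx′) a-blocks b-blocks j {y} y∈ =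
        decidable-stable (κ j y ℕ.≟ κ j (a j) ⊎-dec κ j y ℕ.≟ κ j (b j)) λ neither →
          collide (smaller A′ (shrinks A′⊆A y∈ λ y∈′ → neither (proj₂ (∈⟪⟫⁻ (kept? j) y∈′))) shattered′)
        where
        kept? : ∀ l z → Dec (z ∈ A l × (κ l z ≡ κ l (a l) ⊎ κ l z ≡ κ l (b l)))
        kept? l z = z ∈? A l ×-dec (κ l z ℕ.≟ κ l (a l) ⊎-dec κ l z ℕ.≟ κ l (b l))
        A′ : Family
        A′ l = ⟪ kept? l ⟫
        A′⊆A : ∀ l → A′ l ⊆ˢ A l
        A′⊆A l z∈ = proj₁ (∈⟪⟫⁻ (kept? l) z∈)
        a∈′ : Product A′ a
        a∈′ l = ∈⟪⟫⁺ (kept? l) (a∈ a-blocks l , inj₁ refl)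
        b∈′ : Product A′ b
        b∈′ l = ∈⟪⟫⁺ (kept? l) (a∈ b-blocks l , inj₂ refl)
        shattered′ : ShatteredIn S A′ κ
        shattered′ c c∈′ =
          let s , s∈ , s∈S , same = shattered c (λ l → A′⊆A l (c∈′ l))
          in s
           , (λ l → ∈⟪⟫⁺ (kept? l) (s∈ l , Sum.map (trans (same l)) (trans (same l)) (proj₂ (∈⟪⟫⁻ (kept? l) (c∈′ l)))))
           , s∈S , same
        collide : CopyIn S A′ κ → ⊥
        collide C = x≢x′ (trans (sym (at a-blocks a∈′)) (trans
            (rep-cong (a∈′ i) (b∈′ i) (trans (colour a-blocks) (trans κx≡κx′ (sym (colour b-blocks)))))
            (at b-blocks b∈′)))
          where
          open CopyIn C
          at : ∀ {c z} → Blocking i z c → Product A′ c → rep i (c i) ≡ z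
          at B c∈ = forced B (λ l → A′⊆A l (rep∈ (c∈ l))) (rep⊆ _ c∈) (λ l → rep-colour (c∈ l))

      -- With one colour in each coordinate there is a single box, and one point of S is a copy.
      constant-copy : ∀ a → Product A a → (∀ l {y z} → y ∈ A l → z ∈ A l → κ l y ≡ κ l z) → CopyIn S A κ
      constant-copy a a∈ mono =
        let s , s∈ , s∈S , _ = shattered a a∈
        in record
        { rep        = λ l _ → s l
        ; rep∈       = λ {l} _ → s∈ l
        ; rep-colour = λ {l} y∈ → mono l (s∈ l) y∈
        ; rep-cong   = λ _ _ _ → refl
        ; rep⊆       = λ _ _ → s∈S
        }

      -- The boxes blocking three elements are pairwise opposite, which is
      -- impossible for a coordinate with two colours.
      triplets : ∀ {i x y z} → Twins i x y → Twins i x z → Twins i y z → CopyIn S A κ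
      triplets xy@(x∈ , y∈ , x≢y , κx≡κy) xz yz@(_ , z∈ , y≢z , κy≡κz) =
        block-or-copy xy λ a a-blocks → block-or-copy yz λ b b-blocks →
        block-or-copy (z∈ , y∈ , y≢z ∘ sym , sym κy≡κz) λ c c-blocks →
          constant-copy a (a∈ a-blocks) λ l u∈ v∈ →
            let ab = two-colours xy a-blocks b-blocks l
                ac = two-colours xz a-blocks c-blocks l
                bc = two-colours yz b-blocks c-blocks l
            in majority (ab u∈) (ac u∈) (bc u∈) (ab v∈) (ac v∈) (bc v∈)
                 (ab (a∈ c-blocks l)) (ac (a∈ b-blocks l)) (bc (a∈ a-blocks l))
        where
        -- Each of a, b, c equals one of the other two, so all three agree, and u and v agree with
        -- them.
        majority : ∀ {u v a b c : ℕ} → u ≡ a ⊎ u ≡ b → u ≡ a ⊎ u ≡ c → u ≡ b ⊎ u ≡ c →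
          v ≡ a ⊎ v ≡ b → v ≡ a ⊎ v ≡ c → v ≡ b ⊎ v ≡ c →
          c ≡ a ⊎ c ≡ b → b ≡ a ⊎ b ≡ c → a ≡ b ⊎ a ≡ c → u ≡ v
        majority ua ub uc va vb vc (inj₁ refl) (inj₁ refl) _ = trans ([ id , id ]′ ua) (sym ([ id , id ]′ va))
        majority ua ub uc va vb vc (inj₁ refl) (inj₂ refl) _ = trans ([ id , id ]′ ua) (sym ([ id , id ]′ va))
        majority ua ub uc va vb vc (inj₂ refl) _ (inj₁ refl) = trans ([ id , id ]′ ua) (sym ([ id , id ]′ va))
        majority ua ub uc va vb vc (inj₂ refl) _ (inj₂ refl) = trans ([ id , id ]′ ua) (sym ([ id , id ]′ va))

      twins? : Dec (∃ λ i → ∃₂ (Twins i))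
      twins? = any? λ i → any? λ x → any? λ y →
        x ∈? A i ×-dec y ∈? A i ×-dec ¬? (x Fin.≟ y) ×-dec κ i x ℕ.≟ κ i y

      copy : CopyIn S A κ
      copy with twins?
      -- Each class is a single element, so shattering already puts the whole product into S.
      ... | no ¬twins = record
        { rep        = λ _ x → x
        ; rep∈       = id
        ; rep-colour = λ _ → refl
        ; rep-cong   = injective
        ; rep⊆       = λ a a∈ → let s , s∈ , s∈S , same = shattered a a∈
                                in resp (λ j → injective (s∈ j) (a∈ j) (same j)) s∈S
        }
        where
        injective : ∀ {j x y} → x ∈ A j → y ∈ A j → κ j x ≡ κ j y → x ≡ y
        injective {j} {x} {y} x∈ y∈ eq =
          decidable-stable (x Fin.≟ y) λ x≢y → ¬twins (j , x , y , x∈ , y∈ , x≢y , eq)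
      ... | yes (i , x , y , twins@(x∈ , y∈ , x≢y , κx≡κy)) =
        block-or-copy twins λ a a-blocks →
        block-or-copy (y∈ , x∈ , x≢y ∘ sym , sym κx≡κy) λ b b-blocks →
          finish a a-blocks b b-blocks
        where
        finish : ∀ a → Blocking i x a → ∀ b → Blocking i y b → CopyIn S A κ
        finish a a-blocks b b-blocks with
          -- Does some factor contain two elements besides `a j`?
          any? (λ j → any? λ u → any? λ v →
            u ∈? A j ×-dec v ∈? A j ×-dec ¬? (a j Fin.≟ u) ×-dec ¬? (a j Fin.≟ v) ×-dec ¬? (u Fin.≟ v))
        ... | yes (j , u , v , u∈ , v∈ , a≢u , a≢v , u≢v) = pigeonhole
            (two-colours twins a-blocks b-blocks j u∈) (two-colours twins a-blocks b-blocks j v∈)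
          where
          -- Both blocking boxes have the colour of `w` in coordinate j, so `two-colours` leaves one
          -- colour in `A j`, which contains the three distinct elements `a j`, `u`, `v`.
          monochromatic : ∀ {w z} → Twins j w z → CopyIn S A κ
          monochromatic {w} {z} wz@(w∈ , z∈ , w≢z , κw≡κz) =
            block-or-copy wz λ c c-blocks → block-or-copy (z∈ , w∈ , w≢z ∘ sym , sym κw≡κz) λ d d-blocks →
              let colour-w : ∀ {t} → t ∈ A j → κ j t ≡ κ j w
                  colour-w t∈ = [ (λ eq → trans eq (colour c-blocks)) , (λ eq → trans eq (trans (colour d-blocks) (sym κw≡κz))) ]′
                                (two-colours wz c-blocks d-blocks j t∈)
                  equal : ∀ {s t} → s ∈ A j → t ∈ A j → κ j s ≡ κ j t
                  equal s∈ t∈ = trans (colour-w s∈) (sym (colour-w t∈))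
              in triplets (a∈ a-blocks j , u∈ , a≢u , equal (a∈ a-blocks j) u∈) (a∈ a-blocks j , v∈ , a≢v , equal (a∈ a-blocks j) v∈)
                          (u∈ , v∈ , u≢v , equal u∈ v∈)
          pigeonhole : κ j u ≡ κ j (a j) ⊎ κ j u ≡ κ j (b j) → κ j v ≡ κ j (a j) ⊎ κ j v ≡ κ j (b j) → CopyIn S A κ
          pigeonhole (inj₁ eq) _          = monochromatic (a∈ a-blocks j , u∈ , a≢u , sym eq)
          pigeonhole (inj₂ _)  (inj₁ eq)  = monochromatic (a∈ a-blocks j , v∈ , a≢v , sym eq)
          pigeonhole (inj₂ eq) (inj₂ eq′) = monochromatic (u∈ , v∈ , u≢v , trans eq (sym eq′))
        ... | no ¬three = binary-copy exchange a β (a∈ a-blocks) (λ j → proj₁ (second-spec j)) (λ j → proj₂ (second-spec j)) shattered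
          where
          second : ∀ j → Dec (∃ λ u → u ∈ A j × a j ≢ u)
          second j = any? λ u → u ∈? A j ×-dec ¬? (a j Fin.≟ u)
          -- If `A j` has no second element, `a j` itself is the default.
          β : Tuple n
          β j with second j
          ... | yes (u , _) = u
          ... | no _        = a j
          second-spec : ∀ j → β j ∈ A j × (∀ {t} → t ∈ A j → t ≡ a j ⊎ t ≡ β j)
          second-spec j with second j
          ... | yes (u , u∈ , a≢u) = u∈ , λ {t} t∈ → decidable-stable (t Fin.≟ a j ⊎-dec t Fin.≟ u) λ neither →
            ¬three (j , u , t , u∈ , t∈ , a≢u , (λ eq → neither (inj₁ (sym eq))) , λ eq → neither (inj₂ (sym eq)))
          ... | no none = a∈ a-blocks j , λ {t} t∈ → decidable-stable (t Fin.≟ a j ⊎-dec t Fin.≟ a j) λ neither →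
            none (t , t∈ , λ eq → neither (inj₁ (sym eq)))

    exchange⇒ampleIn : Decidable S → Exchange S → ∀ A → AmpleIn S A
    exchange⇒ampleIn S? exchange A κ = go A (<-wellFounded _)
      where
      go : ∀ A → Acc _<_ ∣ A ∣ᶠ → ShatteredIn S A κ → CopyIn S A κ
      go A (acc rec) shattered = Descent.copy S? exchange shattered λ A′ A′<A → go A′ (rec A′<A)

    exchange⇒ample : Decidable S → Exchange S → Ample S
    exchange⇒ample S? exchange = ampleIn⇒ample {A = λ _ → ⊤} (λ _ _ → ∈⊤) resp (exchange⇒ampleIn S? exchange _)

-- Evaluation of first-order formulas by a program

-- There are two sorts of de Bruijn variables: a for tuples, quantified over S, and b for
-- coordinates. The remaining connectives and the existential quantifier are defined classically.
data Formula (a b : ℕ) : Set where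
  falsum  : Formula a b
  equal   : Fin a → Fin a → Fin b → Formula a b
  same    : Fin b → Fin b → Formula a b
  implies : Formula a b → Formula a b → Formula a b
  for-tuples  : Formula (suc a) b → Formula a b
  for-indices : Formula a (suc b) → Formula a b

everywhere : ∀ {k} → (Fin k → Bool) → Bool
everywhere {zero}  f = true
everywhere {suc k} f = f zero ∧ everywhere (f ∘ suc)

module _ {m} {n : Fin m → ℕ} (S : List (Tuple n)) where

  ⟦_⟧ : ∀ {a b} → Formula a b → (Fin a → Tuple n) → (Fin b → Fin m) → Bool
  ⟦ falsum ⟧        ρ σ = false
  ⟦ equal x y j ⟧   ρ σ = toℕ (ρ x (σ j)) ℕ.≡ᵇ toℕ (ρ y (σ j))
  ⟦ same j k ⟧      ρ σ = toℕ (σ j) ℕ.≡ᵇ toℕ (σ k)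
  ⟦ implies φ ψ ⟧   ρ σ = not (⟦ φ ⟧ ρ σ) ∨ ⟦ ψ ⟧ ρ σ
  ⟦ for-tuples φ ⟧  ρ σ = all (λ s → ⟦ φ ⟧ (s ◂ ρ) σ) S
  ⟦ for-indices φ ⟧ ρ σ = everywhere λ j → ⟦ φ ⟧ ρ (j ◂ σ)

data Tree : Set where
  leaf : Tree
  node : Tree → Tree → Tree

unary : ℕ → Tree
unary zero    = leaf
unary (suc k) = node leaf (unary k)

-- Labels cannot be computed with, so the tags of connectives and the variables are numbers in
-- unary, taken apart by `case`.
code : ∀ {a b} → Formula a b → Tree
code falsum          = leaf
code (equal x y j)   = node (unary 0) (node (unary (toℕ x)) (node (unary (toℕ y)) (unary (toℕ j))))
code (same j k)      = node (unary 1) (node (unary (toℕ j)) (unary (toℕ k)))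
code (implies φ ψ)   = node (unary 2) (node (code φ) (code ψ))
code (for-tuples φ)  = node (unary 3) (code φ)
code (for-indices φ) = node (unary 4) (code φ)

value : Tree → Value
value leaf       = nil
value (node s t) = cons (value s) (value t)

quoted : ∀ {k} {arity : Fin k → ℕ} {l} → Tree → Expr arity l
quoted leaf       = nil
quoted (node s t) = cons (quoted s) (quoted t)

arities : Fin 5 → ℕ
arities = lookup (2 ∷ 2 ∷ 5 ∷ 6 ∷ 7 ∷ [])

pattern nth-f         = zero
pattern same-f        = suc zero
pattern eval-f        = suc (suc zero)
pattern for-tuples-f  = suc (suc (suc zero))
pattern for-indices-f = suc (suc (suc (suc zero)))

truth : ∀ {l} → Expr arities l
truth = cons nil nil

-- The comments name the parameters, in the order of the variables.
bodies : (f : Fin 5) → Expr arities (arities f)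
-- list, position
bodies nth-f =
  case (var (# 1))
    (case (var (# 0)) nil (var (# 0)))
    (case (var (# 2)) nil (call nth-f (var (# 1) ∷ var (# 3) ∷ [])))
-- two numbers in unary
bodies same-f =
  case (var (# 0))
    (case (var (# 1)) truth nil)
    (case (var (# 3)) nil (call same-f (var (# 3) ∷ var (# 1) ∷ [])))
-- formula, tuple assignment, index assignment, S, some list of length m
bodies eval-f =
  case (var (# 0)) nil
    -- The nested `case`s peel off the unary tag. Each cons branch binds two variables and so shifts
    -- the parameters by two.
    (case (var (# 0))
      (case (var (# 1)) nil (case (var (# 1)) nil
        (if-same
          (call nth-f (call nth-f (var (# 7) ∷ var (# 2) ∷ []) ∷ call nth-f (var (# 8) ∷ var (# 1) ∷ []) ∷ []))
          (call nth-f (call nth-f (var (# 7) ∷ var (# 0) ∷ []) ∷ call nth-f (var (# 8) ∷ var (# 1) ∷ []) ∷ []))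
          truth nil)))
      (case (var (# 1))
        (case (var (# 3)) nil
          (call same-f (call nth-f (var (# 8) ∷ var (# 0) ∷ []) ∷ call nth-f (var (# 8) ∷ var (# 1) ∷ []) ∷ [])))
        (case (var (# 1))
          (case (var (# 5)) nil
            (case (call eval-f (var (# 0) ∷ var (# 9) ∷ var (# 10) ∷ var (# 11) ∷ var (# 12) ∷ []))
              truth
              (call eval-f (var (# 3) ∷ var (# 11) ∷ var (# 12) ∷ var (# 13) ∷ var (# 14) ∷ []))))
          (case (var (# 1))
            (call for-tuples-f (var (# 11) ∷ var (# 7) ∷ var (# 9) ∷ var (# 10) ∷ var (# 11) ∷ var (# 12) ∷ []))
            (call for-indices-f (var (# 14) ∷ nil ∷ var (# 9) ∷ var (# 11) ∷ var (# 12) ∷ var (# 13) ∷ var (# 14) ∷ []))))))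
-- remaining tuples, then as for eval-f
bodies for-tuples-f =
  case (var (# 0)) truth
    (case (call eval-f (var (# 3) ∷ cons (var (# 0)) (var (# 4)) ∷ var (# 5) ∷ var (# 6) ∷ var (# 7) ∷ [])) nil
      (call for-tuples-f (var (# 3) ∷ var (# 5) ∷ var (# 6) ∷ var (# 7) ∷ var (# 8) ∷ var (# 9) ∷ [])))
-- a list as long as there are remaining indices, next index, then as for eval-f
bodies for-indices-f =
  case (var (# 0)) truth
    (case (call eval-f (var (# 4) ∷ var (# 5) ∷ cons (var (# 3)) (var (# 6)) ∷ var (# 7) ∷ var (# 8) ∷ [])) nil
      (call for-indices-f (var (# 3) ∷ cons nil (var (# 5)) ∷ var (# 6) ∷ var (# 7) ∷ var (# 8) ∷ var (# 9) ∷ var (# 10) ∷ [])))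

-- On an empty list there is no tuple from which to read off m.
decide : Formula 0 0 → Program
decide φ = record
  { functions = 5
  ; arity     = arities
  ; body      = bodies
  ; main      = case (var (# 0)) truth (call eval-f (quoted (code φ) ∷ nil ∷ nil ∷ var (# 2) ∷ var (# 0) ∷ []))
  }

-- Running time of the evaluator

encodeIndex : ∀ {m} → Fin m → Value
encodeIndex j = value (unary (toℕ j))

values : ∀ {k} → (Fin k → Value) → Value
values g = encodeList (List.tabulate g)

nthCost sameCost : ℕ → ℕ
nthCost k  = 5 + k * 7
sameCost k = 7 + k * 7

-- L is to bound both the length of S and m, hence the rounds of either loop and the positions in a
-- tuple. The constants count the steps spent in the function bodies.
evalCost : ∀ {a b} → Formula a b → ℕ → ℕ
evalCost falsum          L = 3
evalCost (equal x y j)   L = 26 + (nthCost (toℕ x) + nthCost (toℕ y) + 2 * (nthCost (toℕ j) + nthCost L))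
evalCost (same j k)      L = 15 + (nthCost (toℕ j) + nthCost (toℕ k) + sameCost L)
evalCost (implies φ ψ)   L = 26 + (evalCost φ L + evalCost ψ L)
evalCost (for-tuples φ)  L = 22 + L * (19 + evalCost φ L)
evalCost (for-indices φ) L = 23 + L * (22 + evalCost φ L)

quotedCost : Tree → ℕ
quotedCost leaf       = 1
quotedCost (node s t) = 1 + (quotedCost s + quotedCost t)

shuffle : ∀ k l x y → k + (x + (l + y)) ≡ k + l + (x + y)
shuffle = solve-∀

equal-cost : ∀ x y j l →
  9 + ((1 + (3 + x + (3 + j + 0) + l)) + (1 + (3 + y + (3 + j + 0) + l)) + 3) ≡ 26 + (x + y + 2 * (j + l))
equal-cost = solve-∀

same-cost : ∀ j k l → 9 + (3 + j + (3 + k + 0) + l) ≡ 15 + (j + k + l)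
same-cost = solve-∀

module Evaluation (φ₀ : Formula 0 0) where

  open Semantics (decide φ₀)

  -- Bounds instead of exact times let branches of different lengths be treated alike.
  Runs : ∀ {l} → Env l → Expr arities l → Value → ℕ → Set
  Runs ρ e v B = ∃ λ t → ρ ⊢ e ⇓ v ⟨ t ⟩ × t ≤ B

  Runs* : ∀ {l k} → Env l → Vec (Expr arities l) k → Vec Value k → ℕ → Set
  Runs* ρ es vs B = ∃ λ t → ρ ⊢* es ⇓ vs ⟨ t ⟩ × t ≤ B

  module _ {l} {ρ : Env l} where

    within : ∀ {e v B B′} → B ≤ B′ → Runs ρ e v B → Runs ρ e v B′
    within B≤B′ (t , d , t≤B) = t , d , ≤-trans t≤B B≤B′

    run-var : ∀ {x} → Runs ρ (var x) (lookup ρ x) 1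
    run-var = 1 , ⇓var , ≤-refl

    run-nil : Runs ρ nil nil 1
    run-nil = 1 , ⇓nil , ≤-refl

    run-cons : ∀ {e₁ e₂ v₁ v₂ B₁ B₂} → Runs ρ e₁ v₁ B₁ → Runs ρ e₂ v₂ B₂ →
      Runs ρ (cons e₁ e₂) (cons v₁ v₂) (1 + (B₁ + B₂))
    run-cons (_ , d₁ , b₁) (_ , d₂ , b₂) = _ , ⇓cons d₁ d₂ , s≤s (+-mono-≤ b₁ b₂)

    run-truth : Runs ρ truth (encodeBool true) 3
    run-truth = run-cons run-nil run-nil

    run-case-nil : ∀ {e e₁ e₂ v B B₁} → Runs ρ e nil B → Runs ρ e₁ v B₁ →
      Runs ρ (case e e₁ e₂) v (1 + (B + B₁))
    run-case-nil (_ , d , b) (_ , d₁ , b₁) = _ , ⇓case-nil d d₁ , s≤s (+-mono-≤ b b₁)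

    run-case-cons : ∀ {e e₁ e₂ x y v B B₂} → Runs ρ e (cons x y) B → Runs (x ∷ y ∷ ρ) e₂ v B₂ →
      Runs ρ (case e e₁ e₂) v (1 + (B + B₂))
    run-case-cons (_ , d , b) (_ , d₂ , b₂) = _ , ⇓case-cons d d₂ , s≤s (+-mono-≤ b b₂)

    run-if-same : ∀ {e₁ e₂ x y B₁ B₂} → Runs ρ e₁ (atom x) B₁ → Runs ρ e₂ (atom y) B₂ →
      Runs ρ (if-same e₁ e₂ truth nil) (encodeBool (x ℕ.≡ᵇ y)) (1 + (B₁ + B₂ + 3))
    run-if-same {x = x} {y} (_ , d₁ , b₁) (_ , d₂ , b₂) =
      let _ , d , b = branch (x ℕ.≡ᵇ y) in _ , ⇓if-same d₁ d₂ d , s≤s (+-mono-≤ (+-mono-≤ b₁ b₂) b)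
      where
      branch : ∀ c → Runs ρ (if c then truth else nil) (encodeBool c) 3
      branch true  = run-truth
      branch false = within (s≤s z≤n) run-nil

    run-call : ∀ {f es vs v B₁ B₂} → Runs* ρ es vs B₁ → Runs vs (bodies f) v B₂ →
      Runs ρ (call f es) v (1 + (B₁ + B₂))
    run-call (_ , d₁ , b₁) (_ , d₂ , b₂) = _ , ⇓call d₁ d₂ , s≤s (+-mono-≤ b₁ b₂)

    []ʳ : Runs* ρ [] [] 0
    []ʳ = 0 , ⇓[] , z≤n

    infixr 5 _∷ʳ_
    _∷ʳ_ : ∀ {k e v B₁ B₂} {es : Vec (Expr arities l) k} {vs : Vec Value k} →
      Runs ρ e v B₁ → Runs* ρ es vs B₂ → Runs* ρ (e ∷ es) (v ∷ vs) (B₁ + B₂)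
    (_ , d₁ , b₁) ∷ʳ (_ , d₂ , b₂) = _ , ⇓∷ d₁ d₂ , +-mono-≤ b₁ b₂

    run-quoted : ∀ s → Runs ρ (quoted s) (value s) (quotedCost s)
    run-quoted leaf       = run-nil
    run-quoted (node s t) = run-cons (run-quoted s) (run-quoted t)

  run-nth : ∀ {k} (g : Fin k → Value) i →
    Runs (values g ∷ encodeIndex i ∷ []) (bodies nth-f) (g i) (nthCost (toℕ i))
  run-nth g zero    = run-case-nil run-var (run-case-cons run-var run-var)
  run-nth g (suc i) = run-case-cons run-var (run-case-cons run-var
    (run-call (run-var ∷ʳ run-var ∷ʳ []ʳ) (run-nth (g ∘ suc) i)))

  run-same : ∀ j k → Runs (value (unary j) ∷ value (unary k) ∷ []) (bodies same-f) (encodeBool (j ℕ.≡ᵇ k)) (sameCost j)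
  run-same zero    zero    = run-case-nil run-var (run-case-nil run-var run-truth)
  run-same zero    (suc k) = within (m≤m+n 5 2) (run-case-nil run-var (run-case-cons run-var run-nil))
  run-same (suc j) zero    = within (m≤m+n 5 _) (run-case-cons run-var (run-case-nil run-var run-nil))
  run-same (suc j) (suc k) = run-case-cons run-var (run-case-cons run-var
    (run-call (run-var ∷ʳ run-var ∷ʳ []ʳ) (run-same j k)))

  -- True is encoded as `cons nil nil`, hence the two `nil`s in the environment of the second
  -- conjunct. The additional 1 pays for the `nil` of the other branch.
  run-∧ : ∀ {l} {ρ : Env l} {e e′ a b B B′} → Runs ρ e (encodeBool a) B →
    Runs (nil ∷ nil ∷ ρ) e′ (encodeBool b) B′ → Runs ρ (case e nil e′) (encodeBool (a ∧ b)) (1 + (B + (1 + B′)))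
  run-∧ {a = false} r r′ = within (s≤s (+-monoʳ-≤ _ (s≤s z≤n))) (run-case-nil r run-nil)
  run-∧ {a = true}  r r′ = within (s≤s (+-monoʳ-≤ _ (n≤1+n _))) (run-case-cons r r′)

  run-⇒ : ∀ {l} {ρ : Env l} {e e′ a b B B′} → Runs ρ e (encodeBool a) B →
    Runs (nil ∷ nil ∷ ρ) e′ (encodeBool b) B′ → Runs ρ (case e truth e′) (encodeBool (not a ∨ b)) (1 + (B + (3 + B′)))
  run-⇒ {a = false} r r′ = within (s≤s (+-monoʳ-≤ _ (m≤m+n 3 _))) (run-case-nil r run-truth)
  run-⇒ {a = true}  r r′ = within (s≤s (+-monoʳ-≤ _ (m≤n+m _ 3))) (run-case-cons r r′)

  run-lookup : ∀ {k l} {ρ : Env l} (g : Fin k → Value) i {e e′ B B′} →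
    Runs ρ e (values g) B → Runs ρ e′ (encodeIndex i) B′ →
    Runs ρ (call nth-f (e ∷ e′ ∷ [])) (g i) (1 + (B + (B′ + 0) + nthCost (toℕ i)))
  run-lookup g i r r′ = run-call (r ∷ʳ r′ ∷ʳ []ʳ) (run-nth g i)

  module _ {m} {n : Fin m → ℕ} (S : List (Tuple n)) (spine : Fin m → Value) where

    state : ∀ {a b} → (Fin a → Tuple n) → (Fin b → Fin m) → Vec Value 4
    state ρ σ = values (encodeTuple ∘ ρ) ∷ values (encodeIndex ∘ σ) ∷ encode S ∷ values spine ∷ []

    run-for-tuples : ∀ {a b B} (φ : Formula (suc a) b) {ρ : Fin a → Tuple n} {σ : Fin b → Fin m} →
      (∀ s → Runs (value (code φ) ∷ state (s ◂ ρ) σ) (bodies eval-f) (encodeBool (⟦_⟧ S φ (s ◂ ρ) σ)) B) →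
      ∀ xs → Runs (encode xs ∷ value (code φ) ∷ state ρ σ) (bodies for-tuples-f)
        (encodeBool (all (λ s → ⟦_⟧ S φ (s ◂ ρ) σ) xs)) (5 + length xs * (19 + B))
    run-for-tuples φ run []       = run-case-nil run-var run-truth
    run-for-tuples {B = B} φ {ρ} {σ} run (s ∷ xs) = within (≤-reflexive (shuffle 11 13 B (length xs * (19 + B))))
      (run-case-cons run-var (run-∧
      (run-call (run-var ∷ʳ run-cons run-var run-var ∷ʳ run-var ∷ʳ run-var ∷ʳ run-var ∷ʳ []ʳ) (run s))
      (run-call (run-var ∷ʳ run-var ∷ʳ run-var ∷ʳ run-var ∷ʳ run-var ∷ʳ run-var ∷ʳ []ʳ) (run-for-tuples φ run xs))))

    -- Loop invariant: the k indices still to come are numbered consecutively from `next`, the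
    -- counter that grows while the list shrinks.
    run-for-indices : ∀ {a b k B} (φ : Formula a (suc b)) {ρ : Fin a → Tuple n} {σ : Fin b → Fin m} →
      (g : Fin k → Value) (j : Fin k → Fin m) (next : ℕ) → (∀ i → toℕ (j i) ≡ next + toℕ i) →
      (∀ i → Runs (value (code φ) ∷ state ρ (i ◂ σ)) (bodies eval-f) (encodeBool (⟦_⟧ S φ ρ (i ◂ σ))) B) →
      Runs (values g ∷ value (unary next) ∷ value (code φ) ∷ state ρ σ) (bodies for-indices-f)
        (encodeBool (everywhere (λ i → ⟦_⟧ S φ ρ (j i ◂ σ)))) (5 + k * (22 + B))
    run-for-indices {k = zero}  φ g j next eq run = run-case-nil run-var run-truth
    run-for-indices {k = suc k} {B} φ {ρ} {σ} g j next eq run = within (≤-reflexive (shuffle 11 16 B (k * (22 + B))))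
      (run-case-cons run-var (run-∧
      (run-call (run-var ∷ʳ run-var ∷ʳ run-cons run-var run-var ∷ʳ run-var ∷ʳ run-var ∷ʳ []ʳ) first)
      (run-call (run-var ∷ʳ run-cons run-nil run-var ∷ʳ run-var ∷ʳ run-var ∷ʳ run-var ∷ʳ run-var ∷ʳ run-var ∷ʳ []ʳ)
        (run-for-indices φ (g ∘ suc) (j ∘ suc) (suc next) (λ i → trans (eq (suc i)) (+-suc next (toℕ i))) run))))
      where
      first : Runs (value (code φ) ∷ values (encodeTuple ∘ ρ) ∷ cons (value (unary next)) (values (encodeIndex ∘ σ)) ∷
          encode S ∷ values spine ∷ [])
        (bodies eval-f) (encodeBool (⟦_⟧ S φ ρ (j zero ◂ σ))) B
      first = subst (λ x → Runs (value (code φ) ∷ values (encodeTuple ∘ ρ) ∷ cons (value (unary x)) (values (encodeIndex ∘ σ)) ∷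
          encode S ∷ values spine ∷ [])
        (bodies eval-f) (encodeBool (⟦_⟧ S φ ρ (j zero ◂ σ))) B)
        (trans (eq zero) (+-identityʳ next)) (run (j zero))

    private
      L : ℕ
      L = length S + m

      index≤ : ∀ (j : Fin m) → toℕ j ≤ L
      index≤ j = ≤-trans (<⇒≤ (toℕ<n j)) (m≤n+m m (length S))

    run-eval : ∀ {a b} (φ : Formula a b) (ρ : Fin a → Tuple n) (σ : Fin b → Fin m) →
      Runs (value (code φ) ∷ state ρ σ) (bodies eval-f) (encodeBool (⟦_⟧ S φ ρ σ)) (evalCost φ L)
    run-eval falsum ρ σ = run-case-nil run-var run-nil
    run-eval (equal x y j) ρ σ = within (≤-reflexive (equal-cost (nthCost (toℕ x)) (nthCost (toℕ y)) (nthCost (toℕ j)) (nthCost L)))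
      (run-case-cons run-var (run-case-nil run-var (run-case-cons run-var (run-case-cons run-var
      (run-if-same (cell x run-var run-var run-var run-var) (cell y run-var run-var run-var run-var))))))
      where
      cell : ∀ x {l} {env : Env l} {e₁ e₂ e₃ e₄} →
        Runs env e₁ (values (encodeTuple ∘ ρ)) 1 → Runs env e₂ (encodeIndex x) 1 →
        Runs env e₃ (values (encodeIndex ∘ σ)) 1 → Runs env e₄ (encodeIndex j) 1 →
        Runs env (call nth-f (call nth-f (e₁ ∷ e₂ ∷ []) ∷ call nth-f (e₃ ∷ e₄ ∷ []) ∷ [])) (atom (toℕ (ρ x (σ j)))) _
      cell x r₁ r₂ r₃ r₄ = run-call
        (run-lookup (encodeTuple ∘ ρ) x r₁ r₂ ∷ʳ run-lookup (encodeIndex ∘ σ) j r₃ r₄ ∷ʳ []ʳ)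
        (within (+-monoʳ-≤ 5 (*-monoˡ-≤ 7 (index≤ (σ j)))) (run-nth (atom ∘ toℕ ∘ ρ x) (σ j)))
    run-eval (same j k) ρ σ = within (≤-reflexive (same-cost (nthCost (toℕ j)) (nthCost (toℕ k)) (sameCost L)))
      (run-case-cons run-var (run-case-cons run-var (run-case-nil run-var (run-case-cons run-var
      (run-call (run-lookup (encodeIndex ∘ σ) j run-var run-var ∷ʳ run-lookup (encodeIndex ∘ σ) k run-var run-var ∷ʳ []ʳ)
        (within (+-monoʳ-≤ 7 (*-monoˡ-≤ 7 (index≤ (σ j)))) (run-same (toℕ (σ j)) (toℕ (σ k)))))))))
    run-eval (implies φ ψ) ρ σ = within (≤-reflexive (shuffle 17 9 (evalCost φ L) (evalCost ψ L)))
      (run-case-cons run-var (run-case-cons run-var (run-case-cons run-var (run-case-nil run-var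
      (run-case-cons run-var (run-⇒
        (run-call (run-var ∷ʳ run-var ∷ʳ run-var ∷ʳ run-var ∷ʳ run-var ∷ʳ []ʳ) (run-eval φ ρ σ))
        (run-call (run-var ∷ʳ run-var ∷ʳ run-var ∷ʳ run-var ∷ʳ run-var ∷ʳ []ʳ) (run-eval ψ ρ σ))))))))
    run-eval (for-tuples φ) ρ σ = within (+-monoʳ-≤ 22 (*-monoˡ-≤ (19 + evalCost φ L) (m≤m+n (length S) m)))
      (run-case-cons run-var (run-case-cons run-var (run-case-cons run-var (run-case-cons run-var
      (run-case-nil run-var
        (run-call (run-var ∷ʳ run-var ∷ʳ run-var ∷ʳ run-var ∷ʳ run-var ∷ʳ run-var ∷ʳ []ʳ)
          (run-for-tuples φ (λ s → run-eval φ (s ◂ ρ) σ) S)))))))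
    run-eval (for-indices φ) ρ σ = within (+-monoʳ-≤ 23 (*-monoˡ-≤ (22 + evalCost φ L) (m≤n+m m (length S))))
      (run-case-cons run-var (run-case-cons run-var (run-case-cons run-var (run-case-cons run-var
      (run-case-cons run-var
        (run-call (run-var ∷ʳ run-nil ∷ʳ run-var ∷ʳ run-var ∷ʳ run-var ∷ʳ run-var ∷ʳ run-var ∷ʳ []ʳ)
          (run-for-indices φ spine id 0 (λ _ → refl) (λ j → run-eval φ ρ (j ◂ σ)))))))))

-- Polynomial bounds

Polynomial : (ℕ → ℕ) → Set
Polynomial f = ∃₂ λ c d → ∀ L → f L ≤ c * suc L ^ d

poly-const : ∀ k → Polynomial (λ _ → k)
poly-const k = k , 0 , λ _ → ≤-reflexive (sym (*-identityʳ k))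

poly-id : Polynomial (λ L → L)
poly-id = 1 , 1 , λ L → ≤-trans (n≤1+n L) (≤-reflexive (sym (trans (*-identityˡ _) (^-identityʳ (suc L)))))

-- The sum of the two exponents is a common exponent, since the base `suc L` is positive.
poly-+ : ∀ {f g} → Polynomial f → Polynomial g → Polynomial (λ L → f L + g L)
poly-+ {f} {g} (c , d , f≤) (c′ , d′ , g≤) = c + c′ , d + d′ , λ L → begin
  f L + g L                                           ≤⟨ +-mono-≤ (f≤ L) (g≤ L) ⟩
  c * suc L ^ d + c′ * suc L ^ d′                     ≤⟨ +-mono-≤ (*-monoʳ-≤ c (^-monoʳ-≤ (suc L) (m≤m+n d d′)))
                                                                   (*-monoʳ-≤ c′ (^-monoʳ-≤ (suc L) (m≤n+m d′ d))) ⟩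
  c * suc L ^ (d + d′) + c′ * suc L ^ (d + d′)        ≡⟨ *-distribʳ-+ (suc L ^ (d + d′)) c c′ ⟨
  (c + c′) * suc L ^ (d + d′)                         ∎
  where open ≤-Reasoning

poly-* : ∀ {f g} → Polynomial f → Polynomial g → Polynomial (λ L → f L * g L)
poly-* {f} {g} (c , d , f≤) (c′ , d′ , g≤) = c * c′ , d + d′ , λ L → begin
  f L * g L                                 ≤⟨ *-mono-≤ (f≤ L) (g≤ L) ⟩
  (c * suc L ^ d) * (c′ * suc L ^ d′)       ≡⟨ [m*n]*[o*p]≡[m*o]*[n*p] c (suc L ^ d) c′ (suc L ^ d′) ⟩
  (c * c′) * (suc L ^ d * suc L ^ d′)       ≡⟨ cong ((c * c′) *_) (^-distribˡ-+-* (suc L) d d′) ⟨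
  (c * c′) * suc L ^ (d + d′)               ∎
  where open ≤-Reasoning

poly-evalCost : ∀ {a b} (φ : Formula a b) → Polynomial (evalCost φ)
poly-evalCost falsum          = poly-const 3
poly-evalCost (equal x y j)   = poly-+ (poly-const 26) (poly-+ (poly-const (nthCost (toℕ x) + nthCost (toℕ y)))
  (poly-* (poly-const 2) (poly-+ (poly-const (nthCost (toℕ j))) (poly-+ (poly-const 5) (poly-* poly-id (poly-const 7))))))
poly-evalCost (same j k)      = poly-+ (poly-const 15)
  (poly-+ (poly-const (nthCost (toℕ j) + nthCost (toℕ k))) (poly-+ (poly-const 7) (poly-* poly-id (poly-const 7))))
poly-evalCost (implies φ ψ)   = poly-+ (poly-const 26) (poly-+ (poly-evalCost φ) (poly-evalCost ψ))
poly-evalCost (for-tuples φ)  = poly-+ (poly-const 22) (poly-* poly-id (poly-+ (poly-const 19) (poly-evalCost φ)))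
poly-evalCost (for-indices φ) = poly-+ (poly-const 23) (poly-* poly-id (poly-+ (poly-const 22) (poly-evalCost φ)))

-- The exchange property as a formula

neg : ∀ {a b} → Formula a b → Formula a b
neg φ = implies φ falsum

_or_ _and_ : ∀ {a b} → Formula a b → Formula a b → Formula a b
φ or ψ  = implies (neg φ) ψ
φ and ψ = neg (implies φ (neg ψ))

some-tuple : ∀ {a b} → Formula (suc a) b → Formula a b
some-tuple φ = neg (for-tuples (neg φ))

-- The Boolean has the form that `⟦_⟧` computes for `neg`; likewise below, so that proofs of
-- correctness follow the shape of a formula.
neg-reflects : ∀ {P : Set} {x} → Reflects P x → Reflects (¬ P) (not x ∨ false)
neg-reflects (ofʸ p)  = ofⁿ (λ ¬p → ¬p p)
neg-reflects (ofⁿ ¬p) = ofʸ ¬p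

module _ {P Q : Set} where

  or-reflects : ∀ {x y} → Reflects P x → Reflects Q y → Reflects (P ⊎ Q) (not (not x ∨ false) ∨ y)
  or-reflects (ofʸ p)  _        = ofʸ (inj₁ p)
  or-reflects (ofⁿ ¬p) (ofʸ q)  = ofʸ (inj₂ q)
  or-reflects (ofⁿ ¬p) (ofⁿ ¬q) = ofⁿ [ ¬p , ¬q ]′

  and-reflects : ∀ {x y} → Reflects P x → Reflects Q y → Reflects (P × Q) (not (not x ∨ (not y ∨ false)) ∨ false)
  and-reflects (ofⁿ ¬p) _        = ofⁿ (¬p ∘ proj₁)
  and-reflects (ofʸ p)  (ofⁿ ¬q) = ofⁿ (¬q ∘ proj₂)
  and-reflects (ofʸ p)  (ofʸ q)  = ofʸ (p , q)

  reflects-map : ∀ {x} → (P → Q) → (Q → P) → Reflects P x → Reflects Q x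
  reflects-map to from (ofʸ p)  = ofʸ (to p)
  reflects-map to from (ofⁿ ¬p) = ofⁿ (¬p ∘ from)

≡ᵇ-reflects : ∀ {k} (i j : Fin k) → Reflects (i ≡ j) (toℕ i ℕ.≡ᵇ toℕ j)
≡ᵇ-reflects i j = fromEquivalence (toℕ-injective ∘ ≡ᵇ⇒≡ (toℕ i) (toℕ j)) (≡⇒≡ᵇ (toℕ i) (toℕ j) ∘ cong toℕ)

everywhere-reflects : ∀ {k} {P : Pred (Fin k) 0ℓ} {f : Fin k → Bool} →
  (∀ j → Reflects (P j) (f j)) → Reflects (∀ j → P j) (everywhere f)
everywhere-reflects {zero}  r = ofʸ λ ()
everywhere-reflects {suc k} r = reflects-map
  (λ (p , ps) → λ { zero → p ; (suc j) → ps j }) (λ ps → ps zero , ps ∘ suc)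
  (r zero ×-reflects everywhere-reflects (r ∘ suc))

everywhere-cong : ∀ {k} {f g : Fin k → Bool} → (∀ j → f j ≡ g j) → everywhere f ≡ everywhere g
everywhere-cong {zero}  eq = refl
everywhere-cong {suc k} eq = cong₂ _∧_ (eq zero) (everywhere-cong (eq ∘ suc))

all-cong : ∀ {A : Set} {f g : A → Bool} → (∀ x → f x ≡ g x) → ∀ xs → all f xs ≡ all g xs
all-cong eq []       = refl
all-cong eq (x ∷ xs) = cong₂ _∧_ (eq x) (all-cong eq xs)

-- Tuple variable 1 is the tuple before the move and 0 the tuple after it; `y` is shifted past these
-- two. Under the quantifier, index 1 is the coordinate moved.
moved : ∀ {a b} → Fin a → Formula (2 + a) (1 + b)
moved y = for-indices
  ((same (# 0) (# 1) and equal (# 0) (suc (suc y)) (# 0)) or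
   (neg (same (# 0) (# 1)) and equal (# 0) (# 1) (# 0)))

closed : ∀ {a b} → Fin a → Fin a → Formula (1 + a) b
closed x y = implies
  (for-indices (equal (# 0) (suc x) (# 0) or equal (# 0) (suc y) (# 0)))
  (for-indices (some-tuple (moved y)))

-- If S contains x, then S contains the cube with antipodes x and y as soon
-- as, within it, S is closed under moving one coordinate to that of y.
cube : ∀ {a b} → Fin a → Fin a → Formula a b
cube x y = for-tuples (closed x y)

-- Tuple variables 5 to 0 are p, q, p′, q′, r, r′ in this order. Under the quantifier, index 1 is
-- the direction i.
joined : Formula 6 1
joined = cube (# 1) (# 0) and for-indices
  ((same (# 0) (# 1) and (equal (# 1) (# 5) (# 0) and equal (# 0) (# 3) (# 0))) or
   (neg (same (# 0) (# 1)) and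
     ((equal (# 1) (# 5) (# 0) and equal (# 0) (# 4) (# 0)) or
      (equal (# 1) (# 3) (# 0) and equal (# 0) (# 2) (# 0)))))

exchange₄ : Formula 4 0
exchange₄ = implies (cube (# 1) (# 0)) (implies
  (for-indices ((equal (# 3) (# 2) (# 0) and equal (# 1) (# 0) (# 0)) or
                (equal (# 3) (# 1) (# 0) and equal (# 2) (# 0) (# 0))))
  (for-indices (implies (neg (equal (# 3) (# 1) (# 0))) (some-tuple (some-tuple joined)))))

exchange₂ : Formula 2 0
exchange₂ = implies (cube (# 1) (# 0)) (for-tuples (for-tuples exchange₄))

exchangeFormula : Formula 0 0
exchangeFormula = for-tuples (for-tuples exchange₂)

-- Correctness of the formula

module _ {m} {n : Fin m → ℕ} (S : List (Tuple n)) where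

  private
    _∈S : Pred (Tuple n) 0ℓ
    _∈S = elements S

  elements-resp : _∈S Respects _≐_
  elements-resp s≐t = Any.map λ s≐x i → trans (sym (s≐t i)) (s≐x i)

  elements? : Decidable _∈S
  elements? s = Any.any? (λ x → all? λ i → s i Fin.≟ x i) S

  -- Membership in S is up to coordinatewise equality, so truth must not depend on which of two
  -- equal tuples is listed.
  ⟦⟧-cong : ∀ {a b} (φ : Formula a b) {ρ ρ′ : Fin a → Tuple n} {σ} → (∀ x → ρ x ≐ ρ′ x) → ⟦_⟧ S φ ρ σ ≡ ⟦_⟧ S φ ρ′ σ
  ⟦⟧-cong falsum          eq = refl
  ⟦⟧-cong (equal x y j)   {σ = σ} eq = cong₂ (λ u v → toℕ u ℕ.≡ᵇ toℕ v) (eq x (σ j)) (eq y (σ j))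
  ⟦⟧-cong (same j k)      eq = refl
  ⟦⟧-cong (implies φ ψ)   eq = cong₂ (λ u v → not u ∨ v) (⟦⟧-cong φ eq) (⟦⟧-cong ψ eq)
  ⟦⟧-cong (for-tuples φ)  eq = all-cong (λ s → ⟦⟧-cong φ λ { zero i → refl ; (suc x) i → eq x i }) S
  ⟦⟧-cong (for-indices φ) eq = everywhere-cong λ j → ⟦⟧-cong φ {σ = j ◂ _} eq

  private
    all⁺ : ∀ {f : Tuple n → Bool} xs → all f xs ≡ true → ∀ {s} → Member (tupleSetoid n) s xs → ∃ λ x → s ≐ x × f x ≡ true
    all⁺ {f} (x ∷ xs) eq s∈ with f x in fx
    all⁺ (x ∷ xs) eq (here s≐x) | true = x , s≐x , fx
    all⁺ (x ∷ xs) eq (there s∈) | true = all⁺ xs eq s∈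

    all⁻ : ∀ {f : Tuple n → Bool} xs → all f xs ≡ false → ∃ λ x → Member (tupleSetoid n) x xs × f x ≡ false
    all⁻ {f} (x ∷ xs) eq with f x in fx
    ... | false = x , here (λ _ → refl) , fx
    ... | true  = let y , y∈ , fy = all⁻ xs eq in y , there y∈ , fy

  module _ {a b} (φ : Formula (suc a) b) (ρ : Fin a → Tuple n) (σ : Fin b → Fin m) {P : Pred (Tuple n) 0ℓ}
    (r : ∀ s → s ∈S → Reflects (P s) (⟦_⟧ S φ (s ◂ ρ) σ))
    where

    private
      at-cong : ∀ {s t} → s ≐ t → ⟦_⟧ S φ (s ◂ ρ) σ ≡ ⟦_⟧ S φ (t ◂ ρ) σ
      at-cong s≐t = ⟦⟧-cong φ λ { zero → s≐t ; (suc x) i → refl }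

      not-or-false : ∀ {x} → not x ∨ false ≡ false → x ≡ true
      not-or-false {true} _ = refl

      not-or-true : ∀ {x} → not x ∨ false ≡ true → x ≡ false
      not-or-true {false} _ = refl

    -- The assumption `r` is confined to members of S because `cube-reflects` applies only when the
    -- first antipode lies in S.
    for-tuples-reflects : Reflects (∀ s → s ∈S → P s) (⟦_⟧ S (for-tuples φ) ρ σ)
    for-tuples-reflects with all (λ s → ⟦_⟧ S φ (s ◂ ρ) σ) S in eq
    ... | true  = ofʸ λ s s∈ → let x , s≐x , φx = all⁺ S eq s∈
                               in invert (subst (Reflects (P s)) (trans (at-cong s≐x) φx) (r s s∈))
    ... | false = ofⁿ λ ps → let x , x∈ , ¬φx = all⁻ S eq
                             in invert (subst (Reflects (P x)) ¬φx (r x x∈)) (ps x x∈)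

    some-tuple-reflects : Reflects (∃ λ s → s ∈S × P s) (⟦_⟧ S (some-tuple φ) ρ σ)
    some-tuple-reflects with all (λ s → not (⟦_⟧ S φ (s ◂ ρ) σ) ∨ false) S in eq
    ... | true  = ofⁿ λ (s , s∈ , p) → let x , s≐x , φx = all⁺ S eq s∈
                               in invert (subst (Reflects (P s)) (trans (at-cong s≐x) (not-or-true φx)) (r s s∈)) p
    ... | false = let x , x∈ , ¬φx = all⁻ S eq
                  in ofʸ (x , x∈ , invert (subst (Reflects (P x)) (not-or-false ¬φx) (r x x∈)))

  module _ {a b} {ρ : Fin a → Tuple n} {σ : Fin b → Fin m} where

    cube-reflects : ∀ x y → ρ x ∈S → Reflects (FullCube _∈S (ρ x) (ρ y)) (⟦_⟧ S (cube x y) ρ σ)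
    cube-reflects x y x∈S = reflects-map closed⇒full full⇒closed
      (for-tuples-reflects (closed x y) ρ σ λ u _ →
        everywhere-reflects (λ k → or-reflects (≡ᵇ-reflects (u k) (ρ x k)) (≡ᵇ-reflects (u k) (ρ y k)))
        →-reflects everywhere-reflects λ j → some-tuple-reflects (moved y) (u ◂ ρ) (j ◂ σ) λ v _ → everywhere-reflects λ k →
          or-reflects (and-reflects (≡ᵇ-reflects k j) (≡ᵇ-reflects (v k) (ρ y k)))
                      (and-reflects (neg-reflects (≡ᵇ-reflects k j)) (≡ᵇ-reflects (v k) (u k))))
      where
      p q : Tuple n
      p = ρ x
      q = ρ y

      Closed : Set
      Closed = ∀ u → u ∈S → Between p q u → ∀ j → ∃ λ v → v ∈S × ∀ k → (k ≡ j × v k ≡ q k) ⊎ (k ≢ j × v k ≡ u k)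

      closed⇒full : Closed → FullCube _∈S p q
      closed⇒full close u u∈ = let v , v∈S , early , _ = go m in elements-resp (λ k → early k (toℕ<n k)) v∈S
        where
        -- A walk from p to u changes one coordinate at a time: after l steps the tuple agrees with
        -- u below l and with p from l on.
        go : ∀ l → ∃ λ v → v ∈S × (∀ k → toℕ k < l → v k ≡ u k) × (∀ k → l ≤ toℕ k → v k ≡ p k)
        go zero = p , x∈S , (λ _ ()) , λ _ _ → refl
        go (suc l) with go l | l ℕ.<? m
        ... | v , v∈S , early , late | no l≮m = v , v∈S
          , (λ k _ → early k (<-≤-trans (toℕ<n k) (≮⇒≥ l≮m))) , (λ k l<k → late k (<⇒≤ l<k))
        ... | v , v∈S , early , late | yes l<m = advance (u∈ i)
          where
          i = fromℕ< l<m

          early⁺ : ∀ {w : Tuple n} → w i ≡ u i → (∀ k → k ≢ i → w k ≡ v k) → ∀ k → toℕ k < suc l → w k ≡ u k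
          early⁺ at off k k≤l with k Fin.≟ i
          ... | yes refl = at
          ... | no k≢i   = trans (off k k≢i) (early k (≤∧≢⇒< (s≤s⁻¹ k≤l)
                             λ k≡l → k≢i (toℕ-injective (trans k≡l (sym (toℕ-fromℕ< l<m))))))

          v∈ : Between p q v
          v∈ k with toℕ k ℕ.<? l
          ... | yes k<l = Sum.map (trans (early k k<l)) (trans (early k k<l)) (u∈ k)
          ... | no k≮l  = inj₁ (late k (≮⇒≥ k≮l))

          advance : u i ≡ p i ⊎ u i ≡ q i →
            ∃ λ w → w ∈S × (∀ k → toℕ k < suc l → w k ≡ u k) × (∀ k → suc l ≤ toℕ k → w k ≡ p k)
          advance (inj₁ uᵢ≡pᵢ) = v , v∈S
            , early⁺ (trans (late i (≤-reflexive (sym (toℕ-fromℕ< l<m)))) (sym uᵢ≡pᵢ)) (λ _ _ → refl)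
            , (λ k l<k → late k (<⇒≤ l<k))
          advance (inj₂ uᵢ≡qᵢ) with close v v∈S v∈ i
          ... | w , w∈S , spec = w , w∈S , early⁺ (trans (at (spec i)) (sym uᵢ≡qᵢ)) (λ k k≢i → off k≢i (spec k))
            , λ k l<k → trans (off (λ { refl → <-irrefl (sym (toℕ-fromℕ< l<m)) l<k }) (spec k)) (late k (<⇒≤ l<k))
            where
            at : (i ≡ i × w i ≡ q i) ⊎ (i ≢ i × w i ≡ v i) → w i ≡ q i
            at (inj₁ (_ , eq)) = eq
            at (inj₂ (i≢i , _)) = contradiction refl i≢i
            off : ∀ {k} → k ≢ i → (k ≡ i × w k ≡ q k) ⊎ (k ≢ i × w k ≡ v k) → w k ≡ v k
            off k≢i (inj₁ (k≡i , _)) = contradiction k≡i k≢i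
            off k≢i (inj₂ (_ , eq))  = eq

      full⇒closed : FullCube _∈S p q → Closed
      full⇒closed full u _ u∈ j = v , full v v∈ , spec
        where
        v : Tuple n
        v k with k Fin.≟ j
        ... | yes _ = q k
        ... | no _  = u k
        v∈ : Between p q v
        v∈ k with k Fin.≟ j
        ... | yes _ = inj₂ refl
        ... | no _  = u∈ k
        spec : ∀ k → (k ≡ j × v k ≡ q k) ⊎ (k ≢ j × v k ≡ u k)
        spec k with k Fin.≟ j
        ... | yes k≡j = inj₁ (k≡j , refl)
        ... | no k≢j  = inj₂ (k≢j , refl)

  -- This is `Exchange` with tuples restricted to S, in the order in which the formula binds them.
  -- Nothing is lost, since a full cube contains its antipodes.
  ExchangeIn : Set
  ExchangeIn = ∀ p → p ∈S → ∀ q → q ∈S → FullCube _∈S p q → ∀ p′ → p′ ∈S → ∀ q′ → q′ ∈S → FullCube _∈S p′ q′ →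
    Parallel p q p′ q′ → ∀ i → ¬ p i ≡ p′ i →
    ∃ λ r → r ∈S × ∃ λ r′ → r′ ∈S × (FullCube _∈S r r′ × Joins i p q p′ q′ r r′)

  antipode₁ : ∀ {p q} → FullCube _∈S p q → p ∈S
  antipode₁ {p} full = full p λ _ → inj₁ refl

  antipode₂ : ∀ {p q} → FullCube _∈S p q → q ∈S
  antipode₂ {q = q} full = full q λ _ → inj₂ refl

  exchangeIn-reflects : ∀ {ρ σ} → Reflects ExchangeIn (⟦_⟧ S exchangeFormula ρ σ)
  exchangeIn-reflects {ρ} {σ} =
    (for-tuples-reflects (for-tuples exchange₂) ρ σ λ p p∈ →
     for-tuples-reflects exchange₂ (p ◂ ρ) σ λ q _ →
     cube-reflects {ρ = q ◂ p ◂ ρ} {σ} (# 1) (# 0) p∈ →-reflects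
     (for-tuples-reflects (for-tuples exchange₄) (q ◂ p ◂ ρ) σ λ p′ p′∈ →
      for-tuples-reflects exchange₄ (p′ ◂ q ◂ p ◂ ρ) σ λ q′ _ →
      cube-reflects {ρ = q′ ◂ p′ ◂ q ◂ p ◂ ρ} {σ} (# 1) (# 0) p′∈ →-reflects
      everywhere-reflects (λ k →
        or-reflects (and-reflects (≡ᵇ-reflects (p k) (q k)) (≡ᵇ-reflects (p′ k) (q′ k)))
                    (and-reflects (≡ᵇ-reflects (p k) (p′ k)) (≡ᵇ-reflects (q k) (q′ k)))) →-reflects
      everywhere-reflects (λ i →
        neg-reflects (≡ᵇ-reflects (p i) (p′ i)) →-reflects
        some-tuple-reflects (some-tuple joined) (q′ ◂ p′ ◂ q ◂ p ◂ ρ) (i ◂ σ) λ r r∈ →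
        some-tuple-reflects joined (r ◂ q′ ◂ p′ ◂ q ◂ p ◂ ρ) (i ◂ σ) λ r′ _ →
        and-reflects (cube-reflects {ρ = r′ ◂ r ◂ q′ ◂ p′ ◂ q ◂ p ◂ ρ} {i ◂ σ} (# 1) (# 0) r∈)
          (everywhere-reflects λ k →
            or-reflects
              (and-reflects (≡ᵇ-reflects k i) (and-reflects (≡ᵇ-reflects (r k) (p k)) (≡ᵇ-reflects (r′ k) (p′ k))))
              (and-reflects (neg-reflects (≡ᵇ-reflects k i))
                (or-reflects (and-reflects (≡ᵇ-reflects (r k) (p k)) (≡ᵇ-reflects (r′ k) (q k)))
                             (and-reflects (≡ᵇ-reflects (r k) (p′ k)) (≡ᵇ-reflects (r′ k) (q′ k)))))))))

  exchange-reflects : ∀ {ρ σ} → Reflects (Exchange _∈S) (⟦_⟧ S exchangeFormula ρ σ)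
  exchange-reflects {ρ} {σ} = reflects-map to from (exchangeIn-reflects {ρ} {σ})
    where
    to : ExchangeIn → Exchange _∈S
    to ex p q p′ q′ pq p′q′ par i p≢p′ =
      let r , _ , r′ , _ , result = ex p (antipode₁ pq) q (antipode₂ pq) pq p′ (antipode₁ p′q′) q′ (antipode₂ p′q′) p′q′ par i p≢p′
      in r , r′ , result
    from : Exchange _∈S → ExchangeIn
    from ex p _ q _ pq p′ _ q′ _ p′q′ par i p≢p′ =
      let r , r′ , full , joins = ex p q p′ q′ pq p′q′ par i p≢p′
      in r , antipode₁ full , r′ , antipode₂ full , full , joins

  ample-reflects : ∀ {ρ σ} → Reflects (Ample _∈S) (⟦_⟧ S exchangeFormula ρ σ)
  ample-reflects {ρ} {σ} = reflects-map
    (exchange⇒ample elements-resp elements?) (ample⇒exchange elements-resp) (exchange-reflects {ρ} {σ})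

-- The decision procedure and its running time

answer : Formula 0 0 → ∀ {m} {n : Fin m → ℕ} → List (Tuple n) → Bool
answer φ []        = true
answer φ S@(_ ∷ _) = ⟦_⟧ S φ (λ ()) (λ ())

decideCost : Formula 0 0 → ℕ → ℕ
decideCost φ L = 7 + quotedCost (code φ) + evalCost φ L

call-cost : ∀ q e → 3 + (q + 4 + e) ≡ 7 + q + e
call-cost = solve-∀

run-decide : ∀ φ {m} {n : Fin m → ℕ} (S : List (Tuple n)) →
  ∃ λ t → Run (decide φ) (encode S) (encodeBool (answer φ S)) t × t ≤ decideCost φ (length S + m)
run-decide φ [] = within (m≤m+n 5 _) (run-case-nil run-var run-truth)
  where open Evaluation φ
run-decide φ S@(s ∷ _) = within (≤-reflexive (call-cost (quotedCost (code φ)) (evalCost φ (length S + _))))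
  (run-case-cons run-var (run-call (run-quoted (code φ) ∷ʳ run-nil ∷ʳ run-nil ∷ʳ run-var ∷ʳ run-var ∷ʳ []ʳ)
    (run-eval S (λ i → atom (toℕ (s i))) φ (λ ()) (λ ()))))
  where open Evaluation φ

-- With nonempty factors every generalized partition has a box. The empty set misses it, so it
-- shatters nothing.
ample-[] : ∀ {m} {n : Fin m → ℕ} → (∀ i → NonZero (n i)) → Ample (elements {n = n} [])
ample-[] nonZero Λ shattered with shattered (λ i → proj₁ (covering (Λ i) (fromℕ< (ℕ.>-nonZero⁻¹ _ {{nonZero i}}))))
... | _ , () , _

decidable-in-polynomial-time : (φ : Formula 0 0) →
  (∀ {m} {n : Fin m → ℕ} → (∀ i → NonZero (n i)) → ∀ S → Reflects (Ample (elements {n = n} S)) (answer φ S)) →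
  Σ[ p ∈ Program ] Σ[ c ∈ ℕ ] Σ[ d ∈ ℕ ]
    ((m : ℕ) (n : Fin m → ℕ) → (∀ i → NonZero (n i)) →
    (S : List (Tuple n)) → Unique S →
    Σ[ b ∈ Bool ] Σ[ t ∈ ℕ ]
    (Run p (encode S) (encodeBool b) t
    × Reflects (Ample (elements S)) b
    × t ≤ c * suc (length S + m) ^ d))
decidable-in-polynomial-time φ correct =
  -- The constant summand covers `main` and writing out the code of the formula.
  let c , d , bound = poly-+ (poly-const (7 + quotedCost (code φ))) (poly-evalCost φ)
  in decide φ , c , d , λ m n nonZero S _ →
     let t , run , t≤ = run-decide φ S
     in answer φ S , t , run , correct nonZero S , ≤-trans t≤ (bound (length S + m))

answer-reflects : ∀ {m} {n : Fin m → ℕ} → (∀ i → NonZero (n i)) → ∀ S →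
  Reflects (Ample (elements {n = n} S)) (answer exchangeFormula S)
answer-reflects nonZero []        = ofʸ (ample-[] nonZero)
answer-reflects nonZero S@(_ ∷ _) = ample-reflects S {λ ()} {λ ()}

corollary2 : Σ[ p ∈ Program ] Σ[ c ∈ ℕ ] Σ[ d ∈ ℕ ]
    ((m : ℕ) (n : Fin m → ℕ) → (∀ i → NonZero (n i)) →
    (S : List (Tuple n)) → Unique S →
    Σ[ b ∈ Bool ] Σ[ t ∈ ℕ ]
    (Run p (encode S) (encodeBool b) t
    × Reflects (Ample (elements S)) b
    × t ≤ c * suc (length S + m) ^ d))
corollary2 = decidable-in-polynomial-time exchangeFormula answer-reflects
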